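{- Let $k$ be a positive integer, $c\in\{0,1,\dots,k\}$, $n\ge 1$, and let $\lambda$ be a partition contained in $R=(c^{k+1-c})$. Then \[ D_{1^n}(\mathbf u_{w_\lambda})=\sum_{\{x_1,\dots,x_n\}}\mathbf u_{\lambda\setminus\{x_1,\dots,x_n\}}, \] where the sum ranges over all sets of $n$ distinct cells $x_a=(i_a,j_a)$ of $\lambda$, no two in the same row, satisfying (C2): if $i_a>i_b$ and $j_a<j_b$ for some $a,b$, then $(i_a,j_b)\notin\lambda$.
   Context: Affine symmetric group $W$: bijections $w:\mathbb Z\to\mathbb Z$ with $w(m+k+1)=w(m)+k+1$ and $\sum_{m=1}^{k+1}w(m)=\sum_{m=1}^{k+1}m$. For $r\in\{0,\dots,k\}$, $s_r$ exchanges $r+t(k+1)$ and $r+1+t(k+1)$ for all $t$; $s_a:=s_{a\bmod(k+1)}$. $\ell$ is Coxeter length. For $i\not\equiv j$ mod $k+1$, $t_{i,j}$ exchanges $i+t(k+1)$ and $j+t(k+1)$ for all $t$ and fixes other integers. Affine nilCoxeter algebra $\mathbb A$: generated by $\mathbf u_0,\dots,\mathbf u_k$ with $\mathbf u_r^2=0$, $\mathbf u_r\mathbf u_{r+1}\mathbf u_r=\mathbf u_{r+1}\mathbf u_r\mathbf u_{r+1}$ (indices mod $k+1$), $\mathbf u_r\mathbf u_q=\mathbf u_q\mathbf u_r$ if $r-q\not\equiv\pm1$; basis $\mathbf u_w=\mathbf u_{r_1}\cdots\mathbf u_{r_m}$ for reduced $w=s_{r_1}\cdots s_{r_m}$. Marked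 strong order graph: directed multigraph on $W$; for $x,y$ with $\ell(x)=\ell(y)+1$ and every pair of integers $(i,j)$ with $i\le0<j$ and $y\,t_{i,j}=x$, an edge $x\to y$ labelled $y(j)$. $D_{1^n}:\mathbb A\to\mathbb A$ is the linear operator with $D_{1^n}(\mathbf u_w)=\sum\mathbf u_{w_n}$ over all paths $w\xrightarrow{\ell_1}w_1\xrightarrow{\ell_2}\cdots\xrightarrow{\ell_n}w_n$ in this graph with $\ell_1<\ell_2<\cdots<\ell_n$ (i.e. the ascent composition of the label sequence is $[1,1,\dots,1]$). Diagrams: cell $(a,b)$ in row $a$ (from top), column $b$ (from left), residue $(b-a)\bmod(k+1)$. For a set $\mathcal D$ of cells read bottom row to top row, each row right to left, with residues $r_1,\dots,r_m$: $w_{\mathcal D}=s_{r_1}\cdots s_{r_m}$, $\mathbf u_{\mathcal D}=\mathbf u_{r_1}\cdots\mathbf u_{r_m}$. $w_\lambda$ is this for the diagram of $\lambda$; $\lambda\setminus X$ removes the cells of $X$. -}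

module Defs where

open import Data.Nat as ℕ using (ℕ; zero; suc; _≡ᵇ_; _∸_)
open import Data.Integer as ℤ using (ℤ; +_; _+_; _-_; 0ℤ; 1ℤ)
open import Data.Integer.DivMod using (_%ℕ_)
open import Data.Bool using (Bool; true; false; if_then_else_; _∨_; _∧_; not)
open import Data.List using (List; []; _∷_; _++_; map; length)
open import Data.List.Relation.Unary.All using (All)
open import Data.List.Relation.Unary.Linked using (Linked)
open import Data.List.Membership.Propositional using (_∈_)
open import Data.Vec using (Vec; toList)
open import Data.Maybe using (Maybe; just; nothing)
open import Data.Product using (Σ; _×_; _,_; proj₁; proj₂)
open import Data.Unit using (⊤)
open import Data.Irrelevant using (Irrelevant)
open import Function using (id; _∘_)
open import Relation.Nullary using (¬_)
open import Relation.Binary.PropositionalEquality using (_≡_; _≢_; _≗_)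

-- Affine permutations are represented as functions ℤ → ℤ (composition = product).
Perm : Set
Perm = ℤ → ℤ

module _ (k : ℕ) where

  res : ℤ → ℕ
  res m = m %ℕ suc k

  s : ℤ → Perm
  s a m = if res m ≡ᵇ res a then m + 1ℤ
          else if res m ≡ᵇ res (a + 1ℤ) then m - 1ℤ
          else m

  prod : List ℤ → Perm
  prod [] = id
  prod (r ∷ rs) = s r ∘ prod rs

  Length : Perm → ℕ → Set
  Length w m = (Σ (List ℤ) λ ws → (length ws ≡ m) × (prod ws ≗ w))
             × (∀ ws → prod ws ≗ w → m ℕ.≤ length ws)

  Reduced : List ℤ → Set
  Reduced ws = Length (prod ws) (length ws)

  -- reflection t_{i,j} (meaningful for i ≢ j mod k+1)
  t : ℤ → ℤ → Perm
  t i j m = if res m ≡ᵇ res i then m + (j - i)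
            else if res m ≡ᵇ res j then m - (j - i)
            else m

  -- marked strong order edge x → y := x ∘ t_{i,j} for the pair (i,j)
  -- (then y t_{i,j} = x), with i ≤ 0 < j, i ≢ j, ℓ(x) = ℓ(y)+1; label y(j)
  EdgeCond : Perm → ℤ → ℤ → Set
  EdgeCond x i j = (i ℤ.≤ 0ℤ) × (0ℤ ℤ.< j) × (res i ≢ res j)
                 × (Σ ℕ λ m → Length x (suc m) × Length (x ∘ t i j) m)

  Above : Maybe ℤ → ℤ → Set
  Above nothing  _ = ⊤
  Above (just p) l = p ℤ.< l

  IncPath : Perm → Maybe ℤ → List (ℤ × ℤ) → Perm → Set
  IncPath x prev [] v = x ≗ v
  IncPath x prev ((i , j) ∷ ps) v =
    EdgeCond x i j × Above prev ((x ∘ t i j) j)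
    × IncPath (x ∘ t i j) (just ((x ∘ t i j) j)) ps v

  -- paths of length n from w to v counted by the coefficient of u_v in D_{1^n}(u_w)
  D1Paths : ℕ → Perm → Perm → Set
  D1Paths n w v = Σ (Vec (ℤ × ℤ) n) λ ps → Irrelevant (IncPath w nothing (toList ps) v)

-- λ_a (1-indexed; 0 outside)
part : List ℕ → ℕ → ℕ
part _        zero          = 0
part []       (suc _)       = 0
part (p ∷ ps) (suc zero)    = p
part (p ∷ ps) (suc (suc a)) = part ps (suc a)

IsPartition : List ℕ → Set
IsPartition la = Linked (λ a b → b ℕ.≤ a) la × All (1 ℕ.≤_) la

InBox : ℕ → ℕ → List ℕ → Set
InBox k c la = (length la ℕ.≤ suc k ∸ c) × All (ℕ._≤ c) la

Cell : Set
Cell = ℕ × ℕ   -- (row , column), 1-indexed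

_∈D_ : Cell → List ℕ → Set
(a , b) ∈D la = (1 ℕ.≤ b) × (b ℕ.≤ part la a)

rowCells : ℕ → ℕ → List Cell
rowCells a zero    = []
rowCells a (suc b) = (a , suc b) ∷ rowCells a b

readFrom : List ℕ → ℕ → List Cell
readFrom []       a = []
readFrom (p ∷ ps) a = readFrom ps (suc a) ++ rowCells a p

readCells : List ℕ → List Cell
readCells la = readFrom la 1

residue : Cell → ℤ
residue (a , b) = + b - + a

_∈ᵇ_ : Cell → List Cell → Bool
x ∈ᵇ [] = false
x ∈ᵇ (y ∷ ys) = ((proj₁ x ≡ᵇ proj₁ y) ∧ (proj₂ x ≡ᵇ proj₂ y)) ∨ (x ∈ᵇ ys)

removeCells : List Cell → List Cell → List Cell
removeCells X [] = []
removeCells X (c ∷ cs) = if c ∈ᵇ X then removeCells X cs else c ∷ removeCells X cs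

wordOf : List Cell → List ℤ
wordOf = map residue

wλ : ℕ → List ℕ → Perm
wλ k la = prod k (wordOf (readCells la))

wordMinus : List ℕ → List Cell → List ℤ
wordMinus la X = wordOf (removeCells X (readCells la))

-- a set of cells with no two in one row, encoded canonically as list sorted by row
RowSorted : List Cell → Set
RowSorted = Linked (λ x y → proj₁ x ℕ.< proj₁ y)

C2 : List ℕ → List Cell → Set
C2 la X = ∀ x y → x ∈ X → y ∈ X → proj₁ y ℕ.< proj₁ x → proj₂ x ℕ.< proj₂ y
        → ¬ ((proj₁ x , proj₂ y) ∈D la)

ValidX : List ℕ → List Cell → Set
ValidX la X = RowSorted X × All (_∈D la) X × C2 la X

-- sets X contributing u_{λ\X} with nonzero coefficient at u_v
-- (u_{λ\X} = u_{w_{λ\X}} if the reading word is reduced, 0 otherwise)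
XSets : ℕ → ℕ → List ℕ → Perm → Set
XSets k n la v = Σ (Vec Cell n) λ X →
  Irrelevant (ValidX la (toList X) × Reduced k (wordMinus la (toList X))
              × (prod k (wordMinus la (toList X)) ≗ v))

{-# OPTIONS --safe #-}

-- Row a is identified with the position 1 − a ≤ 0 and column b with the position b > 0, so that
-- deleting the letter of the cell (a , b) from the reading word of λ multiplies w_λ on the right by
-- t_{1−a,b}. Since labels increase, a path uses every row at most once and from bottom to top, hence
-- a path is the same as a set of cells with distinct rows. All statements about lengths come
-- from the exchange property: if i < j and w(i) > w(j), a letter of any word of w can be deleted to
-- give w t_{i,j}. In one direction it shows that undoing a deletion increases the length, so a reduced
-- final word forces every step to be a cover; in the other, (C2) holds because a violation would
-- yield a value strictly between the two exchanged by a cover.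

module Submission where

open import Defs
open import Data.Nat using (ℕ; _≤_)
open import Data.List using (List)
open import Function.Bundles using (_↔_; mk↔ₛ′)
open import Data.Nat as ℕ using (zero; suc; _≡ᵇ_)
import Data.Nat.Properties as ℕ
open import Data.Integer as ℤ using (ℤ; +_; -[1+_]; ∣_∣; _+_; _-_; _*_; -_; 0ℤ; 1ℤ)
import Data.Integer.Properties as ℤ
open import Data.Integer.DivMod using (_/ℕ_; n%ℕd<d; a≡a%ℕn+[a/ℕn]*n)
open import Data.Integer.Tactic.RingSolver using (solve-∀)
open import Data.Bool using (true; false; _∧_)
open import Data.List using ([]; _∷_; _++_; length; map; reverse; _ʳ++_)
open import Data.List.Properties
  using (++-assoc; ++-identityʳ; length-map; length-++; reverse-involutive)
open import Data.List.Membership.Propositional using (_∈_)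
open import Data.List.Relation.Unary.All as All using (All; []; _∷_)
import Data.List.Relation.Unary.All.Properties as All
open import Data.List.Relation.Unary.AllPairs using (AllPairs; []; _∷_)
open import Data.List.Relation.Unary.Any using (here; there)
open import Data.List.Relation.Unary.Linked.Properties using (AllPairs⇒Linked; Linked⇒AllPairs)
open import Data.Maybe using (Maybe; just; nothing)
open import Data.Product using (∃; ∃₂; _×_; _,_; proj₁; proj₂)
open import Data.Product.Properties using (≡-dec)
open import Data.Sum using (inj₁; inj₂)
open import Data.Empty using (⊥; ⊥-elim)
open import Data.Unit using (tt)
open import Data.Irrelevant using (Irrelevant; [_])
open import Data.Vec as Vec using (Vec; toList)
import Data.Vec.Properties as Vec
open import Function using (_∘_)
open import Relation.Nullary using (¬_; yes; no)
open import Relation.Nullary.Decidable using (recompute)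
open import Relation.Binary.Definitions using (tri<; tri≈; tri>)
open import Relation.Binary.PropositionalEquality
  using (_≡_; _≢_; _≗_; refl; sym; trans; cong; cong₂; subst; subst₂; module ≡-Reasoning)

-- The box enters through residues: a cell of R has a residue between c - k and c - 1, so `s_c`
-- never occurs and all permutations involved stay in the parabolic subgroup that permutes the
-- window (c - k - 1, c]. Inside this window congruent positions are equal. There `w_λ` is
-- Grassmannian: it sends 1 - a to λ_a + 1 - a and b to b minus the height of column b, both
-- increasing from left to right, so its inversions (1 - a , b) are the cells of λ. These values
-- grow towards the top row, and once row a is used no position at or below it holds a larger value.
-- Hence an increasing label can only come from a higher row.

-- The ring solver proves identities only, so a linear inequality is transported from a known one
-- along an identity between the two differences.
≤-by : ∀ {x y a b} → x ℤ.≤ y → y - x ≡ b - a → a ℤ.≤ b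
≤-by p e = ℤ.0≤i-j⇒j≤i (subst (0ℤ ℤ.≤_) e (ℤ.i≤j⇒0≤j-i p))

<-by : ∀ {x y a b} → x ℤ.< y → y - x ≡ b - a → a ℤ.< b
<-by {x} {y} {a} {b} p e = ℤ.suc[i]≤j⇒i<j (≤-by (ℤ.i<j⇒suc[i]≤j p)
  (trans (lem x y) (trans (cong (_- 1ℤ) e) (sym (lem a b)))))
  where
  lem : ∀ x y → y - (1ℤ + x) ≡ y - x - 1ℤ
  lem = solve-∀

≡-by : ∀ {x y a b : ℤ} → x ≡ y → y - x ≡ b - a → a ≡ b
≡-by {x} {y} {a} {b} p e = ℤ.≤-antisym (≤-by (ℤ.≤-reflexive p) e)
  (≤-by (ℤ.≤-reflexive (sym p)) (trans (lem x y) (trans (cong -_ e) (sym (lem a b)))))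
  where
  lem : ∀ x y → x - y ≡ - (y - x)
  lem = solve-∀

<⇒suc≤ : ∀ {i j} → i ℤ.< j → 1ℤ + i ℤ.≤ j
<⇒suc≤ = ℤ.i<j⇒suc[i]≤j

suc≤⇒< : ∀ {i j} → 1ℤ + i ℤ.≤ j → i ℤ.< j
suc≤⇒< = ℤ.suc[i]≤j⇒i<j

n<n+1 : ∀ n → n ℤ.< n + 1ℤ
n<n+1 n = <-by (ℤ.+<+ (ℕ.s≤s ℕ.z≤n)) (lem n)
  where
  lem : ∀ n → 1ℤ - 0ℤ ≡ n + 1ℤ - n
  lem = solve-∀

≡ᵇ-true : ∀ {m n} → m ≡ n → (m ≡ᵇ n) ≡ true
≡ᵇ-true {zero} refl = refl
≡ᵇ-true {suc m} refl = ≡ᵇ-true {m} refl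

≡ᵇ-false : ∀ m n → m ≢ n → (m ≡ᵇ n) ≡ false
≡ᵇ-false zero zero ne = ⊥-elim (ne refl)
≡ᵇ-false zero (suc n) ne = refl
≡ᵇ-false (suc m) zero ne = refl
≡ᵇ-false (suc m) (suc n) ne = ≡ᵇ-false m n (ne ∘ cong suc)

-- Congruences and reflections

module _ (k : ℕ) where

  private
    N : ℤ
    N = + suc k

  -- Congruence modulo k + 1, as a record so that its arguments can be inferred.
  infix 4 _≋_
  infix 0 _by_
  record _≋_ (a b : ℤ) : Set where
    constructor _by_
    field
      quotient : ℤ
      equality : a ≡ b + quotient * N

  ≋-sym : ∀ {a b} → a ≋ b → b ≋ a
  ≋-sym {b = b} (d by refl) = - d by lem b d N
    where
    lem : ∀ b d n → b ≡ b + d * n + - d * n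
    lem = solve-∀

  ≋-trans : ∀ {a b c} → a ≋ b → b ≋ c → a ≋ c
  ≋-trans {c = c} (d by refl) (e by refl) = (e + d) by lem c d e N
    where
    lem : ∀ c d e n → c + e * n + d * n ≡ c + (e + d) * n
    lem = solve-∀

  ≋-+ : ∀ {a b} x → a ≋ b → a + x ≋ b + x
  ≋-+ {b = b} x (d by refl) = d by lem b x d N
    where
    lem : ∀ b x d n → b + d * n + x ≡ b + x + d * n
    lem = solve-∀

  -- The quotient must be 0: a positive one puts a at or beyond b + N, a negative one puts b at or
  -- beyond a + N.
  ≋-near : ∀ {a b} → a ≋ b → a ℤ.< b + N → b ℤ.< a + N → a ≡ b
  ≋-near {b = b} (+ zero by refl) _ _ = ℤ.+-identityʳ b
  ≋-near {b = b} (+ suc n by refl) a< _ = ⊥-elim (ℤ.<⇒≱ a<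
    (ℤ.+-monoʳ-≤ b (ℤ.+≤+ (ℕ.m≤m+n (suc k) (n ℕ.* suc k)))))
  ≋-near {b = b} (-[1+ n ] by refl) _ b< = ⊥-elim (ℤ.<⇒≱ b<
    (≤-by {x = 0ℤ} {y = + (n ℕ.* suc k)} (ℤ.+≤+ ℕ.z≤n)
      (trans (lem b N (+ (n ℕ.* suc k))) (cong (λ z → b - (b + z + N)) (lem₂ n)))))
    where
    lem : ∀ b n x → x - 0ℤ ≡ b - (b + - (n + x) + n)
    lem = solve-∀
    lem₂ : ∀ n → - (N + + (n ℕ.* suc k)) ≡ -[1+ n ] * N
    lem₂ n = refl

  res⇒≋ : ∀ {a b} → res k a ≡ res k b → a ≋ b
  res⇒≋ {a} {b} e = (a /ℕ suc k - b /ℕ suc k) by (begin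
    a ≡⟨ a≡a%ℕn+[a/ℕn]*n a (suc k) ⟩
    + res k a + a /ℕ suc k * N ≡⟨ cong (λ r → + r + a /ℕ suc k * N) e ⟩
    + res k b + a /ℕ suc k * N ≡⟨ lem (+ res k b) (a /ℕ suc k) (b /ℕ suc k) N ⟩
    + res k b + b /ℕ suc k * N + (a /ℕ suc k - b /ℕ suc k) * N
      ≡⟨ cong (_+ (a /ℕ suc k - b /ℕ suc k) * N) (a≡a%ℕn+[a/ℕn]*n b (suc k)) ⟨
    b + (a /ℕ suc k - b /ℕ suc k) * N ∎)
    where
    open ≡-Reasoning
    lem : ∀ r x y n → r + x * n ≡ r + y * n + (x - y) * n
    lem = solve-∀

  ≋⇒res : ∀ {a b} → a ≋ b → res k a ≡ res k b
  ≋⇒res {a} {b} p = ℤ.+-injective (≋-near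
    (≋-trans (≋-sym (res≋ a)) (≋-trans p (res≋ b))) (bound a b) (bound b a))
    where
    res≋ : ∀ a → a ≋ + res k a
    res≋ a = (a /ℕ suc k) by a≡a%ℕn+[a/ℕn]*n a (suc k)
    bound : ∀ a b → + res k a ℤ.< + res k b + N
    bound a b = ℤ.+<+ (ℕ.<-≤-trans (n%ℕd<d a (suc k)) (ℕ.m≤n+m (suc k) (res k b)))

  ≋̸-near : ∀ {a b} → a ℤ.< b → b ℤ.< a + N → ¬ a ≋ b
  ≋̸-near {b = b} a<b b< e = ℤ.<⇒≢ a<b (≋-near e (ℤ.<-≤-trans a<b (ℤ.i≤i+j b N)) b<)

  ≋-refl : ∀ {a} → a ≋ a
  ≋-refl {a} = 0ℤ by sym (ℤ.+-identityʳ a)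

  ≋-shift : ∀ m d → m + d * N ≋ m
  ≋-shift m d = d by refl

  ≋-up : ∀ {i j m} → m ≋ i → m + (j - i) ≋ j
  ≋-up {i} {j} {m} e = subst (m + (j - i) ≋_) (lem i j) (≋-+ (j - i) e)
    where
    lem : ∀ i j → i + (j - i) ≡ j
    lem = solve-∀

  ≋-down : ∀ {i j m} → m ≋ j → m - (j - i) ≋ i
  ≋-down {i} {j} {m} e = subst (m - (j - i) ≋_) (lem i j) (≋-+ (- (j - i)) e)
    where
    lem : ∀ i j → j - (j - i) ≡ i
    lem = solve-∀

  -- Matching on this view replaces the Boolean residue tests by congruences. `down` also carries
  -- the failure of the first test, in the order in which `s` tries them.
  data SView (r m : ℤ) : ℤ → Set where
    up   : m ≋ r → SView r m (m + 1ℤ)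
    down : ¬ m ≋ r → m ≋ r + 1ℤ → SView r m (m - 1ℤ)
    fix  : ¬ m ≋ r → ¬ m ≋ r + 1ℤ → SView r m m

  s-view : ∀ r m → SView r m (s k r m)
  s-view r m with res k m ℕ.≟ res k r | res k m ℕ.≟ res k (r + 1ℤ)
  ... | yes e | _     rewrite ≡ᵇ-true e = up (res⇒≋ e)
  ... | no ¬e | yes f rewrite ≡ᵇ-false (res k m) _ ¬e | ≡ᵇ-true f =
    down (¬e ∘ ≋⇒res) (res⇒≋ f)
  ... | no ¬e | no ¬f rewrite ≡ᵇ-false (res k m) _ ¬e | ≡ᵇ-false (res k m) _ ¬f =
    fix (¬e ∘ ≋⇒res) (¬f ∘ ≋⇒res)

  data TView (i j m : ℤ) : ℤ → Set where
    at-i : m ≋ i → TView i j m (m + (j - i))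
    at-j : ¬ m ≋ i → m ≋ j → TView i j m (m - (j - i))
    off  : ¬ m ≋ i → ¬ m ≋ j → TView i j m m

  t-view : ∀ i j m → TView i j m (t k i j m)
  t-view i j m with res k m ℕ.≟ res k i | res k m ℕ.≟ res k j
  ... | yes e | _     rewrite ≡ᵇ-true e = at-i (res⇒≋ e)
  ... | no ¬e | yes f rewrite ≡ᵇ-false (res k m) _ ¬e | ≡ᵇ-true f =
    at-j (¬e ∘ ≋⇒res) (res⇒≋ f)
  ... | no ¬e | no ¬f rewrite ≡ᵇ-false (res k m) _ ¬e | ≡ᵇ-false (res k m) _ ¬f =
    off (¬e ∘ ≋⇒res) (¬f ∘ ≋⇒res)

  s-up : ∀ r m → m ≋ r → s k r m ≡ m + 1ℤ
  s-up r m e with s k r m | s-view r m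
  ... | _ | up _     = refl
  ... | _ | down n _ = ⊥-elim (n e)
  ... | _ | fix n _  = ⊥-elim (n e)

  s-down : ∀ r m → ¬ m ≋ r → m ≋ r + 1ℤ → s k r m ≡ m - 1ℤ
  s-down r m ¬e f with s k r m | s-view r m
  ... | _ | up e     = ⊥-elim (¬e e)
  ... | _ | down _ _ = refl
  ... | _ | fix _ n  = ⊥-elim (n f)

  s-fix : ∀ r m → ¬ m ≋ r → ¬ m ≋ r + 1ℤ → s k r m ≡ m
  s-fix r m ¬e ¬f with s k r m | s-view r m
  ... | _ | up e     = ⊥-elim (¬e e)
  ... | _ | down _ f = ⊥-elim (¬f f)
  ... | _ | fix _ _  = refl

  t-at-i : ∀ i j m → m ≋ i → t k i j m ≡ m + (j - i)
  t-at-i i j m e with t k i j m | t-view i j m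
  ... | _ | at-i _   = refl
  ... | _ | at-j n _ = ⊥-elim (n e)
  ... | _ | off n _  = ⊥-elim (n e)

  t-at-j : ∀ i j m → ¬ i ≋ j → m ≋ j → t k i j m ≡ m - (j - i)
  t-at-j i j m i≢j f with t k i j m | t-view i j m
  ... | _ | at-i e   = ⊥-elim (i≢j (≋-trans (≋-sym e) f))
  ... | _ | at-j _ _ = refl
  ... | _ | off _ n  = ⊥-elim (n f)

  t-off : ∀ i j m → ¬ m ≋ i → ¬ m ≋ j → t k i j m ≡ m
  t-off i j m ¬e ¬f with t k i j m | t-view i j m
  ... | _ | at-i e   = ⊥-elim (¬e e)
  ... | _ | at-j _ f = ⊥-elim (¬f f)
  ... | _ | off _ _  = refl

  t-i : ∀ i j → t k i j i ≡ j
  t-i i j = trans (t-at-i i j i ≋-refl) (lem i j)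
    where
    lem : ∀ i j → i + (j - i) ≡ j
    lem = solve-∀

  t-j : ∀ i j → ¬ i ≋ j → t k i j j ≡ i
  t-j i j i≢j = trans (t-at-j i j j i≢j ≋-refl) (lem i j)
    where
    lem : ∀ i j → j - (j - i) ≡ i
    lem = solve-∀

  t-involutive : ∀ i j → ¬ i ≋ j → ∀ m → t k i j (t k i j m) ≡ m
  t-involutive i j i≢j m with t k i j m | t-view i j m
  ... | _ | at-i e   = trans (t-at-j i j _ i≢j (≋-up e)) (lem m (j - i))
    where
    lem : ∀ m x → m + x - x ≡ m
    lem = solve-∀
  ... | _ | at-j _ f = trans (t-at-i i j _ (≋-down f)) (lem m (j - i))
    where
    lem : ∀ m x → m - x + x ≡ m
    lem = solve-∀
  ... | _ | off ¬e ¬f = t-off i j m ¬e ¬f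

  -- Conjugation renames p to i in t_{p,j}. This lets `cover-no-middle` reach t_{i,j} by three
  -- exchanges.
  t-conjugate : ∀ i p j → ¬ i ≋ p → ¬ p ≋ j → ¬ i ≋ j →
                ∀ m → t k i p (t k p j (t k i p m)) ≡ t k i j m
  t-conjugate i p j i≢p p≢j i≢j m with t k i p m | t-view i p m
  ... | _ | at-i e = begin
    t k i p (t k p j (m + (p - i)))
      ≡⟨ cong (t k i p) (t-at-i p j _ m≡p) ⟩
    t k i p (m + (p - i) + (j - p))
      ≡⟨ t-off i p _ (λ f → i≢j (≋-trans (≋-sym f) m≡j)) (λ f → p≢j (≋-trans (≋-sym f) m≡j)) ⟩
    m + (p - i) + (j - p)
      ≡⟨ lem m i p j ⟩
    m + (j - i)
      ≡⟨ t-at-i i j m e ⟨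
    t k i j m ∎
    where
    open ≡-Reasoning
    m≡p : m + (p - i) ≋ p
    m≡p = ≋-up e
    m≡j : m + (p - i) + (j - p) ≋ j
    m≡j = ≋-up m≡p
    lem : ∀ m i p j → m + (p - i) + (j - p) ≡ m + (j - i)
    lem = solve-∀
  ... | _ | at-j m≢i f = begin
    t k i p (t k p j (m - (p - i)))
      ≡⟨ cong (t k i p) (t-off p j _
           (λ g → i≢p (≋-trans (≋-sym m≡i) g)) (λ g → i≢j (≋-trans (≋-sym m≡i) g))) ⟩
    t k i p (m - (p - i))
      ≡⟨ t-at-i i p _ m≡i ⟩
    m - (p - i) + (p - i)
      ≡⟨ lem m (p - i) ⟩
    m
      ≡⟨ t-off i j m m≢i (λ g → p≢j (≋-trans (≋-sym f) g)) ⟨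
    t k i j m ∎
    where
    open ≡-Reasoning
    m≡i : m - (p - i) ≋ i
    m≡i = ≋-down f
    lem : ∀ m x → m - x + x ≡ m
    lem = solve-∀
  ... | _ | off m≢i m≢p with t k p j m | t-view p j m
  ...   | _ | at-i f = ⊥-elim (m≢p f)
  ...   | _ | off _ m≢j = trans (t-off i p m m≢i m≢p) (sym (t-off i j m m≢i m≢j))
  ...   | _ | at-j _ f = begin
    t k i p (m - (j - p))
      ≡⟨ t-at-j i p _ i≢p (≋-down f) ⟩
    m - (j - p) - (p - i)
      ≡⟨ lem m i p j ⟩
    m - (j - i)
      ≡⟨ t-at-j i j m i≢j f ⟨
    t k i j m ∎
    where
    open ≡-Reasoning
    lem : ∀ m i p j → m - (j - p) - (p - i) ≡ m - (j - i)
    lem = solve-∀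

  s-shift : ∀ r m d → s k r (m + d * N) ≡ s k r m + d * N
  s-shift r m d with s k r m | s-view r m
  ... | _ | up e = trans (s-up r _ (≋-trans (≋-shift m d) e)) (lem m (d * N))
    where
    lem : ∀ m x → m + x + 1ℤ ≡ m + 1ℤ + x
    lem = solve-∀
  ... | _ | fix ¬e ¬f = s-fix r _ (¬e ∘ ≋-trans (≋-sym (≋-shift m d)))
                                  (¬f ∘ ≋-trans (≋-sym (≋-shift m d)))
  ... | _ | down ¬e f = trans (s-down r _ (¬e ∘ ≋-trans (≋-sym (≋-shift m d)))
                                          (≋-trans (≋-shift m d) f)) (lem m (d * N))
    where
    lem : ∀ m x → m + x - 1ℤ ≡ m - 1ℤ + x
    lem = solve-∀

  prod-shift : ∀ ws m d → prod k ws (m + d * N) ≡ prod k ws m + d * N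
  prod-shift [] m d = refl
  prod-shift (r ∷ rs) m d = trans (cong (s k r) (prod-shift rs m d)) (s-shift r (prod k rs m) d)

  -- Both integers move by at most one, so their order can only be reversed if a goes up, b goes
  -- down and the gap is 1.
  s-swap : ∀ {r a b} → a ℤ.< b → s k r b ℤ.< s k r a → a ≋ r × b ≡ a + 1ℤ
  s-swap {r} {a} {b} a<b sb<sa with s k r a | s-view r a | s k r b | s-view r b
  ... | _ | up e | _ | up _ = ⊥-elim (ℤ.<-asym a<b (<-by sb<sa (lem a b)))
    where
    lem : ∀ a b → a + 1ℤ - (b + 1ℤ) ≡ a - b
    lem = solve-∀
  ... | _ | up e | _ | down _ _ = e , ℤ.≤-antisym
      (≤-by (<⇒suc≤ sb<sa) (lem a b)) (≤-by (<⇒suc≤ a<b) (lem₂ a b))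
    where
    lem : ∀ a b → a + 1ℤ - (1ℤ + (b - 1ℤ)) ≡ a + 1ℤ - b
    lem = solve-∀
    lem₂ : ∀ a b → b - (1ℤ + a) ≡ b - (a + 1ℤ)
    lem₂ = solve-∀
  ... | _ | up e | _ | fix _ ¬f = ⊥-elim (ℤ.<⇒≱ a<b (≤-by (<⇒suc≤ sb<sa) (lem a b)))
    where
    lem : ∀ a b → a + 1ℤ - (1ℤ + b) ≡ a - b
    lem = solve-∀
  ... | _ | down _ _ | _ | up _ = ⊥-elim (ℤ.<-asym a<b
      (ℤ.<-trans (n<n+1 b) (ℤ.<-trans sb<sa (<-by (n<n+1 a) (lem a)))))
    where
    lem : ∀ a → a + 1ℤ - a ≡ a - (a - 1ℤ)
    lem = solve-∀
  ... | _ | down _ _ | _ | down _ _ = ⊥-elim (ℤ.<-asym a<b (<-by sb<sa (lem a b)))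
    where
    lem : ∀ a b → a - 1ℤ - (b - 1ℤ) ≡ a - b
    lem = solve-∀
  ... | _ | down _ _ | _ | fix _ _ = ⊥-elim (ℤ.<-asym a<b
      (ℤ.<-trans sb<sa (<-by (n<n+1 a) (lem a))))
    where
    lem : ∀ a → a + 1ℤ - a ≡ a - (a - 1ℤ)
    lem = solve-∀
  ... | _ | fix _ _ | _ | up _ = ⊥-elim (ℤ.<-asym a<b (ℤ.<-trans (n<n+1 b) sb<sa))
  ... | _ | fix _ _ | _ | down _ _ = ⊥-elim (ℤ.<⇒≱ a<b (≤-by (<⇒suc≤ sb<sa) (lem a b)))
    where
    lem : ∀ a b → a - (1ℤ + (b - 1ℤ)) ≡ a - b
    lem = solve-∀
  ... | _ | fix _ _ | _ | fix _ _ = ⊥-elim (ℤ.<-asym a<b sb<sa)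

-- The exchange property

module _ (k : ℕ) (1≤k : 1 ℕ.≤ k) where

  private
    N : ℤ
    N = + suc k

  -- Here k ≥ 1 enters: modulo 1 the two classes coincide, and `s` would be a translation instead of
  -- an involution.
  n≋̸n+1 : ∀ n → ¬ _≋_ k n (n + 1ℤ)
  n≋̸n+1 n = ≋̸-near k (n<n+1 n) (ℤ.+-monoʳ-< n (ℤ.+<+ (ℕ.s≤s 1≤k)))

  s-involutive : ∀ r m → s k r (s k r m) ≡ m
  s-involutive r m with s k r m | s-view k r m
  ... | _ | up e = trans (s-down k r _ (λ f → n≋̸n+1 m (≋-trans k e (≋-sym k f))) (≋-+ k 1ℤ e)) (lem m)
    where
    lem : ∀ m → m + 1ℤ - 1ℤ ≡ m
    lem = solve-∀
  ... | _ | down _ f = trans (s-up k r _ (subst (_≋_ k (m - 1ℤ)) (lem₂ r) (≋-+ k (- 1ℤ) f))) (lem m)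
    where
    lem : ∀ m → m - 1ℤ + 1ℤ ≡ m
    lem = solve-∀
    lem₂ : ∀ m → m + 1ℤ - 1ℤ ≡ m
    lem₂ = solve-∀
  ... | _ | fix ¬e ¬f = s-fix k r m ¬e ¬f

  s-injective : ∀ r {a b} → s k r a ≡ s k r b → a ≡ b
  s-injective r {a} {b} e =
    trans (sym (s-involutive r a)) (trans (cong (s k r) e) (s-involutive r b))

  prod-injective : ∀ ws {a b} → prod k ws a ≡ prod k ws b → a ≡ b
  prod-injective [] e = e
  prod-injective (r ∷ rs) e = prod-injective rs (s-injective r e)

  prod-≋ : ∀ ws {a b} → _≋_ k (prod k ws a) (prod k ws b) → _≋_ k a b
  prod-≋ ws {a} {b} (d by e) = d by prod-injective ws (trans e (sym (prod-shift k ws b d)))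

  -- P = `prod k rs` sends i and j to adjacent integers in the classes of r and r + 1, so t_{i,j} is
  -- the conjugate of s_r by P and the letter r cancels.
  s-prod-t : ∀ r rs i j → _≋_ k (prod k rs i) r → prod k rs j ≡ prod k rs i + 1ℤ →
             ∀ m → s k r (prod k rs (t k i j m)) ≡ prod k rs m
  s-prod-t r rs i j ei ej m with t k i j m | t-view k i j m
  ... | _ | at-i (d by refl) = begin
    s k r (P (i + d * N + (j - i)))
      ≡⟨ cong (s k r ∘ P) (lem i j (d * N)) ⟩
    s k r (P (j + d * N))
      ≡⟨ cong (s k r) (trans (prod-shift k rs j d) (trans (cong (_+ d * N) ej) (lem₂ (P i) (d * N)))) ⟩
    s k r (P i + d * N + 1ℤ)
      ≡⟨ s-down k r _ (λ f → n≋̸n+1 (P i + d * N) (≋-trans k e′ (≋-sym k f))) (≋-+ k 1ℤ e′) ⟩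
    P i + d * N + 1ℤ - 1ℤ
      ≡⟨ lem₃ (P i + d * N) ⟩
    P i + d * N
      ≡⟨ prod-shift k rs i d ⟨
    P (i + d * N) ∎
    where
    open ≡-Reasoning
    P = prod k rs
    e′ : _≋_ k (P i + d * N) r
    e′ = ≋-trans k (≋-shift k (P i) d) ei
    lem : ∀ i j x → i + x + (j - i) ≡ j + x
    lem = solve-∀
    lem₂ : ∀ p x → p + 1ℤ + x ≡ p + x + 1ℤ
    lem₂ = solve-∀
    lem₃ : ∀ p → p + 1ℤ - 1ℤ ≡ p
    lem₃ = solve-∀
  ... | _ | at-j _ (d by refl) = begin
    s k r (P (j + d * N - (j - i)))
      ≡⟨ cong (s k r ∘ P) (lem i j (d * N)) ⟩
    s k r (P (i + d * N))
      ≡⟨ cong (s k r) (prod-shift k rs i d) ⟩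
    s k r (P i + d * N)
      ≡⟨ s-up k r _ (≋-trans k (≋-shift k (P i) d) ei) ⟩
    P i + d * N + 1ℤ
      ≡⟨ lem₂ (P i) (d * N) ⟩
    P i + 1ℤ + d * N
      ≡⟨ cong (_+ d * N) ej ⟨
    P j + d * N
      ≡⟨ prod-shift k rs j d ⟨
    P (j + d * N) ∎
    where
    open ≡-Reasoning
    P = prod k rs
    lem : ∀ i j x → j + x - (j - i) ≡ i + x
    lem = solve-∀
    lem₂ : ∀ p x → p + x + 1ℤ ≡ p + 1ℤ + x
    lem₂ = solve-∀
  ... | _ | off ¬e ¬f = s-fix k r _
    (λ e → ¬e (prod-≋ rs (≋-trans k e (≋-sym k ei))))
    (λ e → ¬f (prod-≋ rs (≋-trans k e (subst (_≋_ k (r + 1ℤ)) (sym ej) (≋-sym k (≋-+ k 1ℤ ei))))))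

  -- Along the word, read from the right, the images of i and j change their
  -- relative order at some letter; that letter can be deleted.
  exchange : ∀ ws {i j} → i ℤ.< j → prod k ws j ℤ.< prod k ws i →
             ∃ λ ws′ → length ws ≡ suc (length ws′) × prod k ws′ ≗ prod k ws ∘ t k i j
  exchange [] i<j p = ⊥-elim (ℤ.<-asym i<j p)
  exchange (r ∷ rs) {i} {j} i<j p with ℤ.<-cmp (prod k rs i) (prod k rs j)
  ... | tri> _ _ q with exchange rs i<j q
  ...   | ws′ , e , f = r ∷ ws′ , cong suc e , cong (s k r) ∘ f
  exchange (r ∷ rs) i<j p | tri≈ _ q _ = ⊥-elim (ℤ.<-irrefl (cong (s k r) (sym q)) p)
  exchange (r ∷ rs) {i} {j} i<j p | tri< q _ _ with s-swap k q p
  ... | ei , ej = rs , refl , sym ∘ s-prod-t r rs i j ei ej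

  exchange-≗ : ∀ {x i j} ws → prod k ws ≗ x → i ℤ.< j → x j ℤ.< x i →
               ∃ λ ws′ → length ws ≡ suc (length ws′) × prod k ws′ ≗ x ∘ t k i j
  exchange-≗ {x} {i} {j} ws e i<j p
    with exchange ws i<j (subst₂ ℤ._<_ (sym (e j)) (sym (e i)) p)
  ... | ws′ , l , f = ws′ , l , λ m → trans (f m) (e (t k i j m))

  -- If x(i) < x(j), then x t_{i,j} has the inversion, and an exchange in its word of length m gives
  -- a word of x with m - 1 letters, although x has length m + 1.
  edge-descent : ∀ {x i j m} → i ℤ.< j → ¬ _≋_ k i j → Length k x (suc m) →
                 Length k (x ∘ t k i j) m → x j ℤ.< x i
  edge-descent {x} {i} {j} {m} i<j i≋̸j ((ws , l , e) , min) ((vs , l′ , e′) , _)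
    with ℤ.<-cmp (x i) (x j)
  ... | tri> _ _ p = p
  ... | tri≈ _ p _ = ⊥-elim (ℤ.<-irrefl (prod-injective ws
    (trans (e i) (trans p (sym (e j))))) i<j)
  ... | tri< p _ _ with exchange-≗ {x ∘ t k i j} vs e′ i<j
    (subst₂ ℤ._<_ (cong x (sym (t-j k i j i≋̸j))) (cong x (sym (t-i k i j))) p)
  ...   | us , l″ , f = ⊥-elim (ℕ.<⇒≱ (ℕ.n<1+n m)
    (ℕ.≤-trans (min us λ n → trans (f n) (cong x (t-involutive k i j i≋̸j n)))
      (ℕ.≤-trans (ℕ.n≤1+n _) (ℕ.≤-reflexive (trans (sym l″) l′)))))

  -- With x(i) > x(p) > x(j), three successive exchanges turn a word of x into
  -- one of x t_{i,j}, so the length drops by at least three.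
  cover-no-middle : ∀ {x i p j m} → i ℤ.< p → p ℤ.< j → ¬ _≋_ k i p → ¬ _≋_ k p j → ¬ _≋_ k i j →
                    Length k x (suc m) → Length k (x ∘ t k i j) m →
                    x j ℤ.< x p → x p ℤ.< x i → ⊥
  cover-no-middle {x} {i} {p} {j} {m} i<p p<j i≋̸p p≋̸j i≋̸j ((ws , l , e) , _) (_ , min) xj<xp xp<xi
    with exchange-≗ {x} ws e i<p xp<xi
  ... | ws₁ , l₁ , e₁
    with exchange-≗ {x ∘ t k i p} ws₁ e₁ p<j
           (subst₂ ℤ._<_ (cong x (sym j-fixed)) (cong x (sym (t-j k i p i≋̸p))) (ℤ.<-trans xj<xp xp<xi))
    where
    j-fixed : t k i p j ≡ j
    j-fixed = t-off k i p j (i≋̸j ∘ ≋-sym k) (p≋̸j ∘ ≋-sym k)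
  ... | ws₂ , l₂ , e₂
    with exchange-≗ {x ∘ t k i p ∘ t k p j} ws₂ e₂ i<p
           (subst₂ ℤ._<_ (cong x (sym p-image)) (cong x (sym i-image)) xj<xp)
    where
    p-image : t k i p (t k p j p) ≡ j
    p-image = trans (cong (t k i p) (t-i k p j)) (t-off k i p j (i≋̸j ∘ ≋-sym k) (p≋̸j ∘ ≋-sym k))
    i-image : t k i p (t k p j i) ≡ p
    i-image = trans (cong (t k i p) (t-off k p j i i≋̸p i≋̸j)) (t-i k i p)
  ... | ws₃ , l₃ , e₃ = ℕ.<⇒≱ (subst (length ws₃ ℕ.<_) (sym m≡) (ℕ.m<n⇒m<1+n (ℕ.n<1+n _)))
      (min ws₃ λ n → trans (e₃ n) (cong x (t-conjugate k i p j i≋̸p p≋̸j i≋̸j n)))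
    where
    m≡ : m ≡ suc (suc (length ws₃))
    m≡ = ℕ.suc-injective (trans (sym l) (trans l₁ (cong suc (trans l₂ (cong suc l₃)))))

  -- Only letters congruent to b move an integer across the cut between b and b + 1. `prod->` treats
  -- the other side of the cut.
  prod-≤ : ∀ ws {b m} → All (λ r → ¬ _≋_ k r b) ws → m ℤ.≤ b → prod k ws m ℤ.≤ b
  prod-≤ [] [] m≤b = m≤b
  prod-≤ (r ∷ rs) {b} {m} (r≋̸b ∷ h) m≤b with prod k rs m | prod-≤ rs h m≤b
  ... | n | n≤b with s k r n | s-view k r n
  ...   | _ | up e = ≤-by (<⇒suc≤ (ℤ.≤∧≢⇒< n≤b λ { refl → r≋̸b (≋-sym k e) })) (lem n b)
    where
    lem : ∀ n b → b - (1ℤ + n) ≡ b - (n + 1ℤ)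
    lem = solve-∀
  ...   | _ | down _ _ = ℤ.≤-trans (ℤ.i-j≤i n 1ℤ) n≤b
  ...   | _ | fix _ _ = n≤b

  prod-> : ∀ ws {b m} → All (λ r → ¬ _≋_ k r b) ws → b ℤ.< m → b ℤ.< prod k ws m
  prod-> [] [] b<m = b<m
  prod-> (r ∷ rs) {b} {m} (r≋̸b ∷ h) b<m with prod k rs m | prod-> rs h b<m
  ... | n | b<n with s k r n | s-view k r n
  ...   | _ | up e = ℤ.<-trans b<n (n<n+1 n)
  ...   | _ | fix _ _ = b<n
  ...   | _ | down _ f = ℤ.≤∧≢⇒< (≤-by (<⇒suc≤ b<n) (lem n b)) λ b≡ →
      r≋̸b (subst₂ (_≋_ k) (lem₂ r) (sym b≡) (≋-+ k (- 1ℤ) (≋-sym k f)))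
    where
    lem : ∀ n b → n - (1ℤ + b) ≡ n - 1ℤ - b
    lem = solve-∀
    lem₂ : ∀ n → n + 1ℤ - 1ℤ ≡ n
    lem₂ = solve-∀

-- Reading words of partitions

Desc : List ℕ → Set
Desc = AllPairs (λ p q → q ℕ.≤ p)

module _ (k : ℕ) (1≤k : 1 ℕ.≤ k) (c : ℕ) where

  private
    N : ℤ
    N = + suc k

  perm : List Cell → Perm
  perm X = prod k (wordOf X)

  perm-++ : ∀ X Y m → perm (X ++ Y) m ≡ perm X (perm Y m)
  perm-++ [] Y m = refl
  perm-++ (x ∷ X) Y m = cong (s k (residue x)) (perm-++ X Y m)

  -- Action of a single row of cells

  s-below : ∀ r m → m ℤ.< r → r + 1ℤ ℤ.< m + N → s k r m ≡ m
  s-below r m m<r r< = s-fix k r m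
    (≋̸-near k m<r (ℤ.<-trans (n<n+1 r) r<))
    (≋̸-near k (ℤ.<-trans m<r (n<n+1 r)) r<)

  s-above : ∀ r m → r + 1ℤ ℤ.< m → m ℤ.< r + N → s k r m ≡ m
  s-above r m r<m m< = s-fix k r m
    (≋̸-near k (ℤ.<-trans (n<n+1 r) r<m) m< ∘ ≋-sym k)
    (≋̸-near k r<m (ℤ.<-trans m< (<-by (n<n+1 r) (lem r N))) ∘ ≋-sym k)
    where
    lem : ∀ r n → r + 1ℤ - r ≡ r + 1ℤ + n - (r + n)
    lem = solve-∀

  -- The rightmost letter acts first, so columns 1, ..., q raise 1 - a one step each. Together with
  -- `row-shift`, a row acts on the window as the cycle that sends 1 - a to q + 1 - a and lowers b +
  -- 1 - a by one for 1 ≤ b ≤ q.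
  row-start : ∀ a q → perm (rowCells a q) (1ℤ - + a) ≡ + q + (1ℤ - + a)
  row-start a zero = sym (ℤ.+-identityˡ (1ℤ - + a))
  row-start a (suc q) = begin
    s k (+ suc q - + a) (perm (rowCells a q) (1ℤ - + a))
      ≡⟨ cong (s k (+ suc q - + a)) (trans (row-start a q) (lem (+ q) (+ a))) ⟩
    s k (+ suc q - + a) (+ suc q - + a)
      ≡⟨ s-up k (+ suc q - + a) (+ suc q - + a) (≋-refl k) ⟩
    + suc q - + a + 1ℤ
      ≡⟨ lem₂ (+ suc q) (+ a) ⟩
    + suc q + (1ℤ - + a) ∎
    where
    open ≡-Reasoning
    lem : ∀ q a → q + (1ℤ - a) ≡ 1ℤ + q - a
    lem = solve-∀
    lem₂ : ∀ q a → q - a + 1ℤ ≡ q + (1ℤ - a)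
    lem₂ = solve-∀

  -- v lies below the support [1 - a , q + 1 - a] of the cycle, and the bound by c keeps it above
  -- the translate of that support by -N.
  row-low : ∀ a q v → 1 ℕ.≤ a → q ℕ.≤ c → v ℤ.< 1ℤ - + a → + c ℤ.< v + N →
            perm (rowCells a q) v ≡ v
  row-low a zero v 1≤a q≤c v< c< = refl
  row-low a (suc q) v 1≤a q≤c v< c< =
    trans (cong (s k (+ suc q - + a)) (row-low a q v 1≤a (ℕ.<⇒≤ q≤c) v< c<))
      (s-below (+ suc q - + a) v
        (ℤ.<-≤-trans v< (≤-by (ℤ.+≤+ (ℕ.z≤n {q})) (lem (+ q) (+ a))))
        (ℤ.≤-<-trans (≤-by (ℤ.+-mono-≤ (ℤ.+≤+ q≤c) (ℤ.+≤+ 1≤a)) (lem₂ (+ suc q) (+ a) (+ c))) c<))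
    where
    lem : ∀ q a → q - 0ℤ ≡ 1ℤ + q - a - (1ℤ - a)
    lem = solve-∀
    lem₂ : ∀ q a c → c + a - (q + 1ℤ) ≡ c - (q - a + 1ℤ)
    lem₂ = solve-∀

  row-high : ∀ a q v → a ℕ.+ c ℕ.≤ suc k → + q + (1ℤ - + a) ℤ.< v → v ℤ.≤ + c →
             perm (rowCells a q) v ≡ v
  row-high a zero v a+c≤ v> v≤ = refl
  row-high a (suc q) v a+c≤ v> v≤ =
    trans (cong (s k (+ suc q - + a)) (row-high a q v a+c≤
            (ℤ.<-trans (<-by (n<n+1 (+ q)) (lem₀ (+ q) (+ a))) v>) v≤))
      (s-above (+ suc q - + a) v (ℤ.≤-<-trans (≤-by (ℤ.≤-refl {0ℤ}) (lem (+ suc q) (+ a))) v>)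
        (ℤ.≤-<-trans v≤ (suc≤⇒< (≤-by (ℤ.+-mono-≤ (ℤ.+≤+ a+c≤) (ℤ.+≤+ (ℕ.z≤n {q})))
          (lem₂ (+ q) (+ a) (+ c) N)))))
    where
    lem₀ : ∀ q a → q + 1ℤ - q ≡ 1ℤ + q + (1ℤ - a) - (q + (1ℤ - a))
    lem₀ = solve-∀
    lem : ∀ q a → 0ℤ - 0ℤ ≡ q + (1ℤ - a) - (q - a + 1ℤ)
    lem = solve-∀
    lem₂ : ∀ q a c n → n + q - (a + c + 0ℤ) ≡ 1ℤ + q - a + n - (1ℤ + c)
    lem₂ = solve-∀

  row-shift : ∀ a q b → 1 ℕ.≤ a → a ℕ.+ c ℕ.≤ suc k → q ℕ.≤ c → 1 ℕ.≤ b → b ℕ.≤ q →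
              perm (rowCells a q) (+ b + (1ℤ - + a)) ≡ + b - + a
  row-shift a zero b 1≤a a+c≤ q≤c 1≤b b≤q = ⊥-elim (ℕ.<⇒≱ 1≤b b≤q)
  row-shift a (suc q) b 1≤a a+c≤ q≤c 1≤b b≤q with ℕ.m≤n⇒m<n∨m≡n b≤q
  ... | inj₁ (ℕ.s≤s b≤q′) = trans
    (cong (s k (+ suc q - + a)) (row-shift a q b 1≤a a+c≤ (ℕ.<⇒≤ q≤c) 1≤b b≤q′))
    (s-below (+ suc q - + a) (+ b - + a)
      (ℤ.+-monoˡ-< (- + a) (ℤ.+<+ (ℕ.s≤s b≤q′)))
      (suc≤⇒< (≤-by (ℤ.+-mono-≤ (ℤ.+≤+ a+c≤) (ℤ.+-mono-≤ (ℤ.+≤+ 1≤a)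
          (ℤ.+-mono-≤ (ℤ.+≤+ q≤c) (ℤ.+≤+ 1≤b))))
        (lem (+ suc q) (+ a) (+ b) (+ c) N))))
    where
    lem : ∀ q a b c n → n + (a + (c + b)) - (a + c + (1ℤ + (q + 1ℤ))) ≡ b - a + n - (1ℤ + (q - a + 1ℤ))
    lem = solve-∀
  ... | inj₂ refl = begin
    s k (+ suc q - + a) (perm (rowCells a q) (+ suc q + (1ℤ - + a)))
      ≡⟨ cong (s k (+ suc q - + a)) (row-high a q _ a+c≤
          (ℤ.+-monoˡ-< (1ℤ - + a) (ℤ.+<+ (ℕ.n<1+n q)))
          (≤-by (ℤ.+-mono-≤ (ℤ.+≤+ 1≤a) (ℤ.+≤+ q≤c)) (lem (+ suc q) (+ a) (+ c)))) ⟩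
    s k (+ suc q - + a) (+ suc q + (1ℤ - + a))
      ≡⟨ cong (s k (+ suc q - + a)) (lem₂ (+ suc q) (+ a)) ⟩
    s k (+ suc q - + a) (+ suc q - + a + 1ℤ)
      ≡⟨ s-down k (+ suc q - + a) (+ suc q - + a + 1ℤ) (n≋̸n+1 k 1≤k _ ∘ ≋-sym k) (≋-refl k) ⟩
    + suc q - + a + 1ℤ - 1ℤ
      ≡⟨ lem₃ (+ suc q - + a) ⟩
    + suc q - + a ∎
    where
    open ≡-Reasoning
    lem : ∀ q a c → a + c - (1ℤ + q) ≡ c - (q + (1ℤ - a))
    lem = solve-∀
    lem₂ : ∀ q a → q + (1ℤ - a) ≡ q - a + 1ℤ
    lem₂ = solve-∀
    lem₃ : ∀ q → q + 1ℤ - 1ℤ ≡ q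
    lem₃ = solve-∀

  -- The rows are numbered from a, so the last one is a + length la - 1; `room` bounds it by k + 1 -
  -- c without subtraction.
  record Rows (a : ℕ) (la : List ℕ) : Set where
    constructor rows
    field
      first  : 1 ℕ.≤ a
      room   : a ℕ.+ length la ℕ.+ c ℕ.≤ suc (suc k)
      narrow : All (ℕ._≤ c) la
      desc   : Desc la

  rows-tail : ∀ {a p ps} → Rows a (p ∷ ps) → Rows (suc a) ps
  rows-tail {a} {p} {ps} (rows f r (_ ∷ n) (_ ∷ d)) = rows (ℕ.s≤s ℕ.z≤n)
    (subst (λ z → z ℕ.+ c ℕ.≤ suc (suc k)) (ℕ.+-suc a (length ps)) r) n d

  rows-room : ∀ {a p ps} → Rows a (p ∷ ps) → a ℕ.+ c ℕ.≤ suc k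
  rows-room {a} {p} {ps} R = ℕ.s≤s⁻¹ (ℕ.≤-trans (ℕ.+-monoˡ-≤ c (ℕ.m≤m+n (suc a) (length ps)))
    (Rows.room (rows-tail R)))

  1-suc : ∀ b a → + b + (1ℤ - + suc a) ≡ + b - + a
  1-suc b a = lem (+ b) (+ a)
    where
    lem : ∀ b a → b + (1ℤ - (1ℤ + a)) ≡ b - a
    lem = solve-∀

  b-a<b+1-a : ∀ b a → + b - + a ℤ.< + b + (1ℤ - + a)
  b-a<b+1-a b a = <-by (n<n+1 0ℤ) (lem (+ b) (+ a))
    where
    lem : ∀ b a → 0ℤ + 1ℤ - 0ℤ ≡ b + (1ℤ - a) - (b - a)
    lem = solve-∀

  b+1-a≤b : ∀ b a → 1 ℕ.≤ a → + b + (1ℤ - + a) ℤ.≤ + b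
  b+1-a≤b b a 1≤a = ≤-by (ℤ.+≤+ 1≤a) (lem (+ b) (+ a))
    where
    lem : ∀ b a → a - 1ℤ ≡ b - (b + (1ℤ - a))
    lem = solve-∀

  b+1-a≤c : ∀ {b} a → 1 ℕ.≤ a → b ℕ.≤ c → + b + (1ℤ - + a) ℤ.≤ + c
  b+1-a≤c {b} a 1≤a b≤c = ℤ.≤-trans (b+1-a≤b b a 1≤a) (ℤ.+≤+ b≤c)

  col-mono : ∀ {b b′} a → b ℕ.< b′ → + b + (1ℤ - + a) ℤ.< + b′ + (1ℤ - + a)
  col-mono a b<b′ = ℤ.+-monoˡ-< (1ℤ - + a) (ℤ.+<+ b<b′)

  1-a-anti : ∀ {a a′} → a ℕ.< a′ → 1ℤ - + a′ ℤ.< 1ℤ - + a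
  1-a-anti a<a′ = ℤ.+-monoʳ-< 1ℤ (ℤ.neg-mono-< (ℤ.+<+ a<a′))

  1-a-window : ∀ a → a ℕ.+ c ℕ.≤ suc k → + c ℤ.< 1ℤ - + a + N
  1-a-window a h = suc≤⇒< (≤-by (ℤ.+≤+ h) (lem (+ a) (+ c) N))
    where
    lem : ∀ a c n → n - (a + c) ≡ 1ℤ - a + n - (1ℤ + c)
    lem = solve-∀

  -- Values of the reading word at row and column positions

  read-high : ∀ {la a} → Rows a la → ∀ h v → All (ℕ._≤ h) la → + h + (1ℤ - + a) ℤ.< v →
              v ℤ.≤ + c → perm (readFrom la a) v ≡ v
  read-high {[]} R h v _ _ _ = refl
  read-high {p ∷ ps} {a} R h v (p≤h ∷ ps≤h) h<v v≤c = begin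
    perm (readFrom ps (suc a) ++ rowCells a p) v
      ≡⟨ perm-++ (readFrom ps (suc a)) (rowCells a p) v ⟩
    perm (readFrom ps (suc a)) (perm (rowCells a p) v)
      ≡⟨ cong (perm (readFrom ps (suc a))) (row-high a p v (rows-room R)
          (ℤ.≤-<-trans (ℤ.+-monoˡ-≤ (1ℤ - + a) (ℤ.+≤+ p≤h)) h<v) v≤c) ⟩
    perm (readFrom ps (suc a)) v
      ≡⟨ read-high (rows-tail R) h v ps≤h
          (ℤ.<-trans (ℤ.+-monoʳ-< (+ h) (1-a-anti (ℕ.n<1+n a))) h<v) v≤c ⟩
    v ∎
    where open ≡-Reasoning

  -- Rows a, ..., a + i - 1 act first and fix 1 - (a + i), which is below their supports. Row a + i
  -- lifts it, and the rows further down, being no longer, fix the result.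
  read-row : ∀ {la a} → Rows a la → ∀ i → a ℕ.+ i ℕ.+ c ℕ.≤ suc k →
             perm (readFrom la a) (1ℤ - + (a ℕ.+ i)) ≡ + part la (suc i) + (1ℤ - + (a ℕ.+ i))
  read-row {[]} {a} R i h = sym (ℤ.+-identityˡ (1ℤ - + (a ℕ.+ i)))
  read-row {p ∷ ps} {a} R@(rows 1≤a _ (p≤c ∷ _) (ps≤p ∷ _)) zero h rewrite ℕ.+-identityʳ a = begin
    perm (readFrom ps (suc a) ++ rowCells a p) (1ℤ - + a)
      ≡⟨ perm-++ (readFrom ps (suc a)) (rowCells a p) _ ⟩
    perm (readFrom ps (suc a)) (perm (rowCells a p) (1ℤ - + a))
      ≡⟨ cong (perm (readFrom ps (suc a))) (row-start a p) ⟩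
    perm (readFrom ps (suc a)) (+ p + (1ℤ - + a))
      ≡⟨ read-high (rows-tail R) p _ ps≤p (ℤ.+-monoʳ-< (+ p) (1-a-anti (ℕ.n<1+n a)))
          (b+1-a≤c a 1≤a p≤c) ⟩
    + p + (1ℤ - + a) ∎
    where open ≡-Reasoning
  read-row {p ∷ ps} {a} R@(rows 1≤a _ (p≤c ∷ _) (ps≤p ∷ _)) (suc i) h rewrite ℕ.+-suc a i = begin
    perm (readFrom ps (suc a) ++ rowCells a p) (1ℤ - + suc (a ℕ.+ i))
      ≡⟨ perm-++ (readFrom ps (suc a)) (rowCells a p) _ ⟩
    perm (readFrom ps (suc a)) (perm (rowCells a p) (1ℤ - + suc (a ℕ.+ i)))
      ≡⟨ cong (perm (readFrom ps (suc a))) (row-low a p (1ℤ - + suc (a ℕ.+ i)) 1≤a p≤c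
          (1-a-anti (ℕ.s≤s (ℕ.m≤m+n a i))) (1-a-window (suc (a ℕ.+ i)) h)) ⟩
    perm (readFrom ps (suc a)) (1ℤ - + suc (a ℕ.+ i))
      ≡⟨ read-row (rows-tail R) i h ⟩
    + part ps (suc i) + (1ℤ - + suc (a ℕ.+ i)) ∎
    where open ≡-Reasoning

  -- Column b reaches row a at the value b + 1 - a, and each row containing it lowers it by one, to
  -- the starting value for the next row. Started at a = 1, this gives b minus the height of the
  -- column.
  read-col-∈ : ∀ {p ps a b} → Rows a (p ∷ ps) → 1 ℕ.≤ b → b ℕ.≤ p →
               perm (readFrom (p ∷ ps) a) (+ b + (1ℤ - + a)) ≡
               perm (readFrom ps (suc a)) (+ b + (1ℤ - + suc a))
  read-col-∈ {p} {ps} {a} {b} R@(rows 1≤a _ (p≤c ∷ _) _) 1≤b b≤p = begin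
    perm (readFrom ps (suc a) ++ rowCells a p) (+ b + (1ℤ - + a))
      ≡⟨ perm-++ (readFrom ps (suc a)) (rowCells a p) _ ⟩
    perm (readFrom ps (suc a)) (perm (rowCells a p) (+ b + (1ℤ - + a)))
      ≡⟨ cong (perm (readFrom ps (suc a)))
          (trans (row-shift a p b 1≤a (rows-room R) p≤c 1≤b b≤p) (sym (1-suc b a))) ⟩
    perm (readFrom ps (suc a)) (+ b + (1ℤ - + suc a)) ∎
    where open ≡-Reasoning

  read-col-∉ : ∀ {p ps a b} → Rows a (p ∷ ps) → p ℕ.< b → b ℕ.≤ c →
               perm (readFrom (p ∷ ps) a) (+ b + (1ℤ - + a)) ≡ + b + (1ℤ - + a)
  read-col-∉ {p} {ps} {a} {b} R@(rows 1≤a _ _ (ps≤p ∷ _)) p<b b≤c =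
    read-high R p _ (ℕ.≤-refl ∷ ps≤p) (col-mono a p<b) (b+1-a≤c a 1≤a b≤c)

  read-col-≤ : ∀ {la a b} → Rows a la → 1 ℕ.≤ b → b ℕ.≤ c →
               perm (readFrom la a) (+ b + (1ℤ - + a)) ℤ.≤ + b + (1ℤ - + a)
  read-col-≤ {[]} R 1≤b b≤c = ℤ.≤-refl
  read-col-≤ {p ∷ ps} {a} {b} R 1≤b b≤c with b ℕ.≤? p
  ... | yes b≤p = ℤ.≤-trans (ℤ.≤-reflexive (read-col-∈ R 1≤b b≤p))
    (ℤ.≤-trans (read-col-≤ (rows-tail R) 1≤b b≤c) (ℤ.+-monoʳ-≤ (+ b) (ℤ.<⇒≤ (1-a-anti (ℕ.n<1+n a)))))
  ... | no b≰p = ℤ.≤-reflexive (read-col-∉ R (ℕ.≰⇒> b≰p) b≤c)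

  part-≤ : ∀ {p} ps i → All (ℕ._≤ p) ps → part ps i ℕ.≤ p
  part-≤ ps zero _ = ℕ.z≤n
  part-≤ [] (suc i) _ = ℕ.z≤n
  part-≤ (q ∷ ps) (suc zero) (q≤p ∷ _) = q≤p
  part-≤ (q ∷ ps) (suc (suc i)) (_ ∷ h) = part-≤ ps (suc i) h

  -- At least i + 1 rows of `la` reach column b, and each lowers its value by one. `read-col->` is
  -- the opposite bound, when at most i rows do.
  read-col-< : ∀ {la a b} → Rows a la → 1 ℕ.≤ b → ∀ i → b ℕ.≤ part la (suc i) →
               perm (readFrom la a) (+ b + (1ℤ - + a)) ℤ.≤ + b - + (a ℕ.+ i)
  read-col-< {[]} R 1≤b i b≤ = ⊥-elim (ℕ.<⇒≱ 1≤b b≤)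
  read-col-< {p ∷ ps} {a} {b} R@(rows _ _ (p≤c ∷ _) _) 1≤b zero b≤ rewrite ℕ.+-identityʳ a =
    ℤ.≤-trans (ℤ.≤-reflexive (read-col-∈ R 1≤b b≤))
      (ℤ.≤-trans (read-col-≤ (rows-tail R) 1≤b (ℕ.≤-trans b≤ p≤c)) (ℤ.≤-reflexive (1-suc b a)))
  read-col-< {p ∷ ps} {a} {b} R@(rows _ _ _ (ps≤p ∷ _)) 1≤b (suc i) b≤ rewrite ℕ.+-suc a i =
    ℤ.≤-trans (ℤ.≤-reflexive (read-col-∈ R 1≤b (ℕ.≤-trans b≤ (part-≤ ps (suc i) ps≤p))))
      (read-col-< (rows-tail R) 1≤b i b≤)

  read-col-> : ∀ {la a b} → Rows a la → 1 ℕ.≤ b → b ℕ.≤ c → ∀ i → part la (suc i) ℕ.< b →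
               + b + (1ℤ - + (a ℕ.+ i)) ℤ.≤ perm (readFrom la a) (+ b + (1ℤ - + a))
  read-col-> {[]} {a} {b} R 1≤b b≤c i _ =
    ℤ.+-monoʳ-≤ (+ b) (ℤ.+-monoʳ-≤ 1ℤ (ℤ.neg-mono-≤ (ℤ.+≤+ (ℕ.m≤m+n a i))))
  read-col-> {p ∷ ps} {a} {b} R 1≤b b≤c i p<b with b ℕ.≤? p
  ... | no b≰p = subst (+ b + (1ℤ - + (a ℕ.+ i)) ℤ.≤_) (sym (read-col-∉ R (ℕ.≰⇒> b≰p) b≤c))
    (ℤ.+-monoʳ-≤ (+ b) (ℤ.+-monoʳ-≤ 1ℤ (ℤ.neg-mono-≤ (ℤ.+≤+ (ℕ.m≤m+n a i)))))
  read-col-> {p ∷ ps} {a} {b} R 1≤b b≤c zero p<b | yes b≤p = ⊥-elim (ℕ.<⇒≱ p<b b≤p)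
  read-col-> {p ∷ ps} {a} {b} R 1≤b b≤c (suc i) p<b | yes b≤p rewrite ℕ.+-suc a i =
    subst (+ b + (1ℤ - + suc (a ℕ.+ i)) ℤ.≤_) (sym (read-col-∈ R 1≤b b≤p))
      (read-col-> (rows-tail R) 1≤b b≤c i p<b)

  -- Every letter of the word exchanges the values b − a and b − a + 1, found at the positions
  -- 1 − a and b in this order, so it creates a new inversion.
  data Good : List Cell → Set where
    []  : Good []
    _∷_ : ∀ {a b V} → perm V (1ℤ - + a) ≡ + b - + a × perm V (+ b) ≡ + b + (1ℤ - + a)
          × 1ℤ - + a ℤ.< + b → Good V → Good ((a , b) ∷ V)

  good-++⁻ : ∀ U {V} → Good (U ++ V) → Good V
  good-++⁻ [] g = g
  good-++⁻ (_ ∷ U) (_ ∷ g) = good-++⁻ U g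

  1-a<b : ∀ {a b} → 1 ℕ.≤ a → 1 ℕ.≤ b → 1ℤ - + a ℤ.< + b
  1-a<b {a} {b} 1≤a 1≤b = suc≤⇒< (≤-by (ℤ.+-mono-≤ (ℤ.+≤+ 1≤a) (ℤ.+≤+ 1≤b)) (lem (+ a) (+ b)))
    where
    lem : ∀ a b → a + b - (1ℤ + 1ℤ) ≡ b - (1ℤ + (1ℤ - a))
    lem = solve-∀

  -- V is the word of what acts before row a. The letter of column q + 1 then finds 1 - a raised to
  -- q + 1 - a by the cells to its left, and its own column still at q + 2 - a.
  good-row : ∀ {a V} q → 1 ℕ.≤ a → a ℕ.+ c ℕ.≤ suc k → q ℕ.≤ c → Good V →
             perm V (1ℤ - + a) ≡ 1ℤ - + a →
             (∀ b → 1 ℕ.≤ b → b ℕ.≤ q → perm V (+ b) ≡ + b + (1ℤ - + a)) →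
             Good (rowCells a q ++ V)
  good-row zero _ _ _ g _ _ = g
  good-row {a} {V} (suc q) 1≤a a+c≤ q≤c g left right =
    ((begin
      perm (rowCells a q ++ V) (1ℤ - + a)
        ≡⟨ perm-++ (rowCells a q) V _ ⟩
      perm (rowCells a q) (perm V (1ℤ - + a))
        ≡⟨ cong (perm (rowCells a q)) left ⟩
      perm (rowCells a q) (1ℤ - + a)
        ≡⟨ row-start a q ⟩
      + q + (1ℤ - + a)
        ≡⟨ lem (+ q) (+ a) ⟩
      + suc q - + a ∎)
    , (begin
      perm (rowCells a q ++ V) (+ suc q)
        ≡⟨ perm-++ (rowCells a q) V _ ⟩
      perm (rowCells a q) (perm V (+ suc q))
        ≡⟨ cong (perm (rowCells a q)) (right (suc q) (ℕ.s≤s ℕ.z≤n) ℕ.≤-refl) ⟩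
      perm (rowCells a q) (+ suc q + (1ℤ - + a))
        ≡⟨ row-high a q _ a+c≤ (col-mono a (ℕ.n<1+n q)) (b+1-a≤c a 1≤a q≤c) ⟩
      + suc q + (1ℤ - + a) ∎)
    , 1-a<b 1≤a (ℕ.s≤s ℕ.z≤n))
    ∷ good-row q 1≤a a+c≤ (ℕ.<⇒≤ q≤c) g left (λ b 1≤b b≤q → right b 1≤b (ℕ.m≤n⇒m≤1+n b≤q))
    where
    open ≡-Reasoning
    lem : ∀ q a → q + (1ℤ - a) ≡ 1ℤ + q - a
    lem = solve-∀

  -- Generalised over the word V of the rows already applied: it fixes the row positions still to
  -- come and has lowered by a - 1 every column up to h, a bound for the remaining rows.
  good-read : ∀ {la a V h} → Rows a la → Good V → All (ℕ._≤ h) la →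
              (∀ a′ → a ℕ.≤ a′ → a′ ℕ.+ c ℕ.≤ suc k → perm V (1ℤ - + a′) ≡ 1ℤ - + a′) →
              (∀ b → 1 ℕ.≤ b → b ℕ.≤ h → perm V (+ b) ≡ + b + (1ℤ - + a)) →
              Good (readFrom la a ++ V)
  good-read {[]} R g _ _ _ = g
  good-read {p ∷ ps} {a} {V} R@(rows 1≤a _ (p≤c ∷ _) (ps≤p ∷ _)) g (p≤h ∷ _) left right =
    subst Good (sym (++-assoc (readFrom ps (suc a)) (rowCells a p) V))
      (good-read {h = p} (rows-tail R)
        (good-row p 1≤a (rows-room R) p≤c g (left a ℕ.≤-refl (rows-room R))
          (λ b 1≤b b≤p → right b 1≤b (ℕ.≤-trans b≤p p≤h)))
        ps≤p
        (λ a′ a<a′ h → trans (perm-++ (rowCells a p) V _) (trans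
          (cong (perm (rowCells a p)) (left a′ (ℕ.<⇒≤ a<a′) h))
          (row-low a p _ 1≤a p≤c (1-a-anti a<a′) (1-a-window a′ h))))
        (λ b 1≤b b≤p → trans (perm-++ (rowCells a p) V _) (trans
          (cong (perm (rowCells a p)) (right b 1≤b (ℕ.≤-trans b≤p p≤h)))
          (trans (row-shift a p b 1≤a (rows-room R) p≤c 1≤b b≤p) (sym (1-suc b a))))))

  good-readCells : ∀ {la} → Rows 1 la → Good (readCells la)
  good-readCells {la} R = subst Good (++-identityʳ (readCells la))
    (good-read {h = c} R [] (Rows.narrow R) (λ _ _ _ → refl) (λ b _ _ → sym (ℤ.+-identityʳ (+ b))))

  -- The two values stored in `Good` are consecutive and start at the residue of the cell, as
  -- `s-prod-t` demands.
  good-t : ∀ {a b V} → Good ((a , b) ∷ V) →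
           ∀ m → perm ((a , b) ∷ V) (t k (1ℤ - + a) (+ b) m) ≡ perm V m
  good-t {a} {b} {V} ((left , right , _) ∷ _) =
    s-prod-t k 1≤k (residue (a , b)) (wordOf V) (1ℤ - + a) (+ b)
      (subst (λ z → _≋_ k z (+ b - + a)) (sym left) (≋-refl k))
      (trans right (trans (lem (+ b) (+ a)) (cong (_+ 1ℤ) (sym left))))
    where
    lem : ∀ b a → b + (1ℤ - a) ≡ b - a + 1ℤ
    lem = solve-∀

  -- The leading letter creates the inversion (1 - a , b), so any word of this permutation loses a
  -- letter by exchange and becomes a word of the tail, where induction applies.
  good-reduced : ∀ {X} → Good X → Reduced k (wordOf X)
  good-reduced [] = ([] , refl , λ _ → refl) , λ _ _ → ℕ.z≤n
  good-reduced {(a , b) ∷ V} G@((left , right , i<j) ∷ g) =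
    (wordOf ((a , b) ∷ V) , refl , λ _ → refl) , minimal
    where
    X = (a , b) ∷ V
    r = residue (a , b)
    i = 1ℤ - + a
    Xj≡ : perm X (+ b) ≡ perm V i
    Xj≡ = trans (cong (perm X) (sym (t-i k i (+ b)))) (good-t G i)
    Xi≡ : perm X i ≡ perm V i + 1ℤ
    Xi≡ = s-up k r _ (subst (λ z → _≋_ k z r) (sym left) (≋-refl k))
    minimal : ∀ ws → prod k ws ≗ perm X → suc (length (wordOf V)) ℕ.≤ length ws
    minimal ws e with exchange-≗ k 1≤k {perm X} ws e i<j (subst₂ ℤ._<_ (sym Xj≡) (sym Xi≡) (n<n+1 _))
    ... | ws′ , l , e′ = subst (suc (length (wordOf V)) ℕ.≤_) (sym l)
      (ℕ.s≤s (proj₂ (good-reduced g) ws′ λ m → trans (e′ m) (good-t G m)))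

  -- Deleting cells from the reading word

  row-split : ∀ a b p → 1 ℕ.≤ b → b ℕ.≤ p → ∃₂ λ U V → rowCells a p ≡ U ++ (a , b) ∷ V
              × All (_≢ (a , b)) U × All (λ x → x ≢ (a , b) × proj₁ x ℕ.≤ a) V
  row-split a b zero 1≤b b≤p = ⊥-elim (ℕ.<⇒≱ 1≤b b≤p)
  row-split a b (suc p) 1≤b b≤p with ℕ.m≤n⇒m<n∨m≡n b≤p
  ... | inj₂ refl = [] , rowCells a p , refl , [] , below p (ℕ.n<1+n p)
    where
    below : ∀ q → q ℕ.< suc p → All (λ x → x ≢ (a , suc p) × proj₁ x ℕ.≤ a) (rowCells a q)
    below zero _ = []
    below (suc q) q<p = ((λ { refl → ℕ.<-irrefl refl q<p }) , ℕ.≤-refl) ∷ below q (ℕ.<⇒≤ q<p)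
  ... | inj₁ (ℕ.s≤s b≤p′) with row-split a b p 1≤b b≤p′
  ...   | U , V , e , hU , hV = (a , suc p) ∷ U , V , cong ((a , suc p) ∷_) e
    , (λ { refl → ℕ.<-irrefl refl b≤p′ }) ∷ hU , hV

  row-rows : ∀ a p → All (λ x → proj₁ x ≡ a) (rowCells a p)
  row-rows a zero = []
  row-rows a (suc p) = refl ∷ row-rows a p

  read-rows : ∀ la a → All (λ x → a ℕ.≤ proj₁ x) (readFrom la a)
  read-rows [] a = []
  read-rows (p ∷ ps) a = All.++⁺ (All.map (ℕ.≤-trans (ℕ.n≤1+n a)) (read-rows ps (suc a)))
    (All.map (ℕ.≤-reflexive ∘ sym) (row-rows a p))

  read-split : ∀ la a i b → 1 ℕ.≤ b → b ℕ.≤ part la (suc i) →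
               ∃₂ λ U V → readFrom la a ≡ U ++ (a ℕ.+ i , b) ∷ V
               × All (_≢ (a ℕ.+ i , b)) U × All (λ x → x ≢ (a ℕ.+ i , b) × proj₁ x ℕ.≤ a ℕ.+ i) V
  read-split [] a i b 1≤b b≤ = ⊥-elim (ℕ.<⇒≱ 1≤b b≤)
  read-split (p ∷ ps) a zero b 1≤b b≤ rewrite ℕ.+-identityʳ a with row-split a b p 1≤b b≤
  ... | U , V , e , hU , hV = readFrom ps (suc a) ++ U , V
    , trans (cong (readFrom ps (suc a) ++_) e) (sym (++-assoc (readFrom ps (suc a)) U _))
    , All.++⁺ (All.map (λ { a<a refl → ℕ.<-irrefl refl a<a }) (read-rows ps (suc a))) hU , hV
  read-split (p ∷ ps) a (suc i) b 1≤b b≤ rewrite ℕ.+-suc a i with read-split ps (suc a) i b 1≤b b≤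
  ... | U , V , e , hU , hV = U , V ++ rowCells a p
    , trans (cong (_++ rowCells a p) e) (++-assoc U _ (rowCells a p)) , hU
    , All.++⁺ hV (All.map
        (λ e′ → (λ x≡y → ℕ.<-irrefl (trans (sym e′) (cong proj₁ x≡y)) (ℕ.s≤s (ℕ.m≤m+n a i)))
              , ℕ.≤-trans (ℕ.≤-reflexive e′) (ℕ.≤-trans (ℕ.m≤m+n a i) (ℕ.n≤1+n _)))
        (row-rows a p))

  ≡ᵇ-cell : ∀ {x y : Cell} → x ≢ y → ((proj₁ x ≡ᵇ proj₁ y) ∧ (proj₂ x ≡ᵇ proj₂ y)) ≡ false
  ≡ᵇ-cell {a , b} {a′ , b′} x≢y with a ℕ.≟ a′
  ... | no a≢ rewrite ≡ᵇ-false a a′ a≢ = refl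
  ... | yes refl rewrite ≡ᵇ-true {a} refl = ≡ᵇ-false b b′ (x≢y ∘ cong (a ,_))

  ∈ᵇ-head : ∀ x X → (x ∈ᵇ (x ∷ X)) ≡ true
  ∈ᵇ-head (a , b) X rewrite ≡ᵇ-true {a} refl | ≡ᵇ-true {b} refl = refl

  ∈ᵇ-tail : ∀ {x y} X → x ≢ y → (x ∈ᵇ (y ∷ X)) ≡ (x ∈ᵇ X)
  ∈ᵇ-tail {x} {y} X x≢y rewrite ≡ᵇ-cell {x} {y} x≢y = refl

  ∉⇒∈ᵇ-false : ∀ {x} X → All (x ≢_) X → (x ∈ᵇ X) ≡ false
  ∉⇒∈ᵇ-false [] [] = refl
  ∉⇒∈ᵇ-false (y ∷ X) (x≢y ∷ h) = trans (∈ᵇ-tail X x≢y) (∉⇒∈ᵇ-false X h)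

  remove-++ : ∀ X U V → removeCells X (U ++ V) ≡ removeCells X U ++ removeCells X V
  remove-++ X [] V = refl
  remove-++ X (u ∷ U) V with u ∈ᵇ X
  ... | true = remove-++ X U V
  ... | false = cong (u ∷_) (remove-++ X U V)

  remove-none : ∀ {X V} → All (λ x → (x ∈ᵇ X) ≡ false) V → removeCells X V ≡ V
  remove-none [] = refl
  remove-none (e ∷ h) rewrite e = cong (_ ∷_) (remove-none h)

  remove-other : ∀ {y U} Y → All (_≢ y) U → removeCells (y ∷ Y) U ≡ removeCells Y U
  remove-other Y [] = refl
  remove-other {y} {u ∷ U} Y (u≢y ∷ h) rewrite ∈ᵇ-tail {u} {y} Y u≢y with u ∈ᵇ Y
  ... | true = remove-other Y h
  ... | false = cong (u ∷_) (remove-other Y h)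

  remove-nil : ∀ V → removeCells [] V ≡ V
  remove-nil [] = refl
  remove-nil (v ∷ V) = cong (v ∷_) (remove-nil V)

  -- The last component exhibits y ∷ V as a suffix of the full reading word, so that it inherits
  -- `Good`.
  remove-split : ∀ {y Y la} → y ∈D la → All (λ z → proj₁ y ℕ.< proj₁ z) Y →
                 ∃₂ λ U V → removeCells Y (readCells la) ≡ U ++ y ∷ V
                 × removeCells (y ∷ Y) (readCells la) ≡ U ++ V
                 × (∃ λ U′ → readCells la ≡ U′ ++ y ∷ V)
  remove-split {zero , b} (1≤b , b≤) _ = ⊥-elim (ℕ.<⇒≱ 1≤b b≤)
  remove-split {y@(suc i , b)} {Y} {la} (1≤b , b≤) y<Y with read-split la 1 i b 1≤b b≤
  ... | U , V , e , hU , hV = removeCells Y U , V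
    , trans (cong (removeCells Y) e) (trans (remove-++ Y U (y ∷ V)) (cong (removeCells Y U ++_)
        (remove-none
          (∉⇒∈ᵇ-false Y (All.map (λ { y<z refl → ℕ.<-irrefl refl y<z }) y<Y) ∷ All.map free hV))))
    , trans (cong (removeCells (y ∷ Y)) e) (trans (remove-++ (y ∷ Y) U (y ∷ V))
        (cong₂ _++_ (remove-other Y hU) (trans y-removed (remove-none (All.map free′ hV)))))
    , U , e
    where
    free : ∀ {x} → x ≢ y × proj₁ x ℕ.≤ suc i → (x ∈ᵇ Y) ≡ false
    free (_ , x≤y) = ∉⇒∈ᵇ-false Y (All.map (λ { y<z refl → ℕ.<⇒≱ y<z x≤y }) y<Y)
    free′ : ∀ {x} → x ≢ y × proj₁ x ℕ.≤ suc i → (x ∈ᵇ (y ∷ Y)) ≡ false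
    free′ h@(x≢y , _) = trans (∈ᵇ-tail Y x≢y) (free h)
    y-removed : removeCells (y ∷ Y) (y ∷ V) ≡ removeCells (y ∷ Y) V
    y-removed rewrite ∈ᵇ-head y Y = refl

  -- The rows of Y are below that of y, so removing Y leaves the cells read after y untouched.
  deletion : ∀ {y Y la} → Rows 1 la → y ∈D la → All (λ z → proj₁ y ℕ.< proj₁ z) Y →
             (∀ m → prod k (wordMinus la Y) (t k (1ℤ - + proj₁ y) (+ proj₂ y) m)
                    ≡ prod k (wordMinus la (y ∷ Y)) m)
             × length (wordMinus la Y) ≡ suc (length (wordMinus la (y ∷ Y)))
  deletion {y} {Y} {la} R y∈ y<Y with remove-split {Y = Y} y∈ y<Y
  ... | U , V , e , e′ , U′ , e″ rewrite e | e′ = word , len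
    where
    word : ∀ m → perm (U ++ y ∷ V) (t k (1ℤ - + proj₁ y) (+ proj₂ y) m) ≡ perm (U ++ V) m
    word m = trans (perm-++ U (y ∷ V) _) (trans
      (cong (perm U) (good-t (good-++⁻ U′ (subst Good e″ (good-readCells R))) m)) (sym (perm-++ U V m)))
    len : length (wordOf (U ++ y ∷ V)) ≡ suc (length (wordOf (U ++ V)))
    len = trans (length-map residue (U ++ y ∷ V)) (trans (length-++ U)
      (trans (ℕ.+-suc (length U) (length V))
        (cong suc (sym (trans (length-map residue (U ++ V)) (length-++ U))))))

  -- No residue is congruent to c

  row-cells : ∀ a p → All (λ x → proj₁ x ≡ a × 1 ℕ.≤ proj₂ x × proj₂ x ℕ.≤ p) (rowCells a p)
  row-cells a zero = []
  row-cells a (suc p) = (refl , ℕ.s≤s ℕ.z≤n , ℕ.≤-refl)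
    ∷ All.map (λ (e , l , u) → e , l , ℕ.m≤n⇒m≤1+n u) (row-cells a p)

  -- The residue is below c because b ≤ c and a ≥ 1, and above c - (k + 1) because a ≤ k + 1 - c and
  -- b ≥ 1.
  cell-≋̸ : ∀ {a b} → 1 ℕ.≤ a → a ℕ.+ c ℕ.≤ suc k → 1 ℕ.≤ b → b ℕ.≤ c → ¬ _≋_ k (+ b - + a) (+ c)
  cell-≋̸ {a} {b} 1≤a h 1≤b b≤c = ≋̸-near k
    (suc≤⇒< (≤-by (ℤ.+-mono-≤ (ℤ.+≤+ 1≤a) (ℤ.+≤+ b≤c)) (lem (+ a) (+ b) (+ c))))
    (suc≤⇒< (≤-by (ℤ.+-mono-≤ (ℤ.+≤+ h) (ℤ.+≤+ 1≤b)) (lem₂ (+ a) (+ b) (+ c) N)))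
    where
    lem : ∀ a b c → a + c - (1ℤ + b) ≡ c - (1ℤ + (b - a))
    lem = solve-∀
    lem₂ : ∀ a b c n → n + b - (a + c + 1ℤ) ≡ b - a + n - (1ℤ + c)
    lem₂ = solve-∀

  read-≋̸ : ∀ {la a} → Rows a la → All (λ x → ¬ _≋_ k (residue x) (+ c)) (readFrom la a)
  read-≋̸ {[]} R = []
  read-≋̸ {p ∷ ps} {a} R@(rows 1≤a _ (p≤c ∷ _) _) = All.++⁺ (read-≋̸ (rows-tail R))
    (All.map (λ { {_ , b} (refl , 1≤b , b≤p) → cell-≋̸ 1≤a (rows-room R) 1≤b (ℕ.≤-trans b≤p p≤c) })
      (row-cells a p))

  remove-All : ∀ {P : Cell → Set} X {V} → All P V → All P (removeCells X V)
  remove-All X [] = []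
  remove-All X {v ∷ V} (p ∷ ps) with v ∈ᵇ X
  ... | true = remove-All X ps
  ... | false = p ∷ remove-All X ps

  wordMinus-≋̸ : ∀ {la} → Rows 1 la → ∀ X → All (λ r → ¬ _≋_ k r (+ c)) (wordMinus la X)
  wordMinus-≋̸ R X = All.map⁺ (remove-All X (read-≋̸ R))

-- Paths and sets of cells

Sorted : List Cell → Set
Sorted = AllPairs (λ x y → proj₁ x ℕ.< proj₁ y)

pos : ℕ → ℤ
pos a = 1ℤ - + a

edge : Cell → ℤ × ℤ
edge (a , b) = pos a , + b

cell : ℤ × ℤ → Cell
cell (i , j) = ∣ 1ℤ - i ∣ , ∣ j ∣

cell-edge : ∀ x → cell (edge x) ≡ x
cell-edge (a , b) = cong (λ i → ∣ i ∣ , b) (lem (+ a))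
  where
  lem : ∀ a → 1ℤ - (1ℤ - a) ≡ a
  lem = solve-∀

edge-cell : ∀ {i j} → i ℤ.≤ 0ℤ → 0ℤ ℤ.< j → edge (cell (i , j)) ≡ (i , j)
edge-cell {i} {j} i≤0 0<j = cong₂ _,_
  (trans (cong (λ z → 1ℤ - z) (ℤ.0≤i⇒+∣i∣≡i
    (≤-by {b = 1ℤ - i} (ℤ.+-mono-≤ i≤0 (ℤ.+≤+ (ℕ.z≤n {1}))) (lem i)))) (lem₂ i))
  (ℤ.0≤i⇒+∣i∣≡i (ℤ.<⇒≤ 0<j))
  where
  lem : ∀ i → 0ℤ + 1ℤ - (i + 0ℤ) ≡ 1ℤ - i - 0ℤ
  lem = solve-∀
  lem₂ : ∀ i → 1ℤ - (1ℤ - i) ≡ i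
  lem₂ = solve-∀

-- Reversed, because a path starts in the lowest row while `RowSorted` lists the highest row first.
toCells : ∀ {n} → Vec (ℤ × ℤ) n → Vec Cell n
toCells ps = Vec.reverse (Vec.map cell ps)

toEdges : ∀ {n} → Vec Cell n → Vec (ℤ × ℤ) n
toEdges X = Vec.map edge (Vec.reverse X)

toList-toEdges : ∀ {n} (X : Vec Cell n) → toList (toEdges X) ≡ map edge (reverse (toList X))
toList-toEdges X = trans (Vec.toList-map edge (Vec.reverse X)) (cong (map edge) (Vec.toList-reverse X))

toCells-toEdges : ∀ {n} (X : Vec Cell n) → toCells (toEdges X) ≡ X
toCells-toEdges X = Vec.reverse-reverse (begin
  Vec.reverse X                          ≡⟨ Vec.map-id (Vec.reverse X) ⟨
  Vec.map (λ x → x) (Vec.reverse X)      ≡⟨ Vec.map-cong cell-edge (Vec.reverse X) ⟨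
  Vec.map (cell ∘ edge) (Vec.reverse X)  ≡⟨ Vec.map-∘ cell edge (Vec.reverse X) ⟩
  Vec.map cell (toEdges X) ∎)
  where open ≡-Reasoning

-- `cell` takes absolute values; the condition i ≤ 0 < j on every edge of a path makes this
-- lossless.
toEdges-toCells : ∀ k {n} (ps : Vec (ℤ × ℤ) n) {x prev v} → IncPath k x prev (toList ps) v →
                  toEdges (toCells ps) ≡ ps
toEdges-toCells k ps path =
  trans (cong (Vec.map edge) (Vec.reverse-involutive (Vec.map cell ps))) (go ps path)
  where
  go : ∀ {n} (ps : Vec (ℤ × ℤ) n) {x prev v} → IncPath k x prev (toList ps) v →
       Vec.map edge (Vec.map cell ps) ≡ ps
  go Vec.[] _ = refl
  go (_ Vec.∷ ps) ((i≤0 , 0<j , _) , _ , p) = cong₂ Vec._∷_ (edge-cell i≤0 0<j) (go ps p)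

module _ (k : ℕ) (1≤k : 1 ℕ.≤ k) (c : ℕ) (c≤k : c ℕ.≤ k) (la : List ℕ) (R : Rows k 1≤k c 1 la) where

  private
    N : ℤ
    N = + suc k

    w : Perm
    w = wλ k la

  -- Rows and columns inside the residue window

  _above_ : ℕ → List Cell → Set
  a above Y = All (λ y → a ℕ.< proj₁ y) Y

  -- The value of `w` at the position of row a, and so the label of an edge that deletes a cell of
  -- this row.
  val : ℕ → ℤ
  val a = + part la a + pos a

  reflect : Cell → ℤ → ℤ
  reflect (a , b) = t k (pos a) (+ b)

  part-anti : ∀ {a a′} → 1 ℕ.≤ a → a ℕ.≤ a′ → part la a′ ℕ.≤ part la a
  part-anti = go (Rows.desc R)
    where
    go : ∀ {la a a′} → Desc la → 1 ℕ.≤ a → a ℕ.≤ a′ → part la a′ ℕ.≤ part la a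
    go {a = suc a} {suc a′} [] _ _ = ℕ.≤-refl
    go {a = suc zero} {suc zero} (_ ∷ _) _ _ = ℕ.≤-refl
    go {p ∷ ps} {suc zero} {suc (suc a′)} (h ∷ _) _ _ = part-≤ k 1≤k c ps (suc a′) h
    go {a = suc (suc a)} {suc (suc a′)} (_ ∷ d) _ (ℕ.s≤s a≤a′) = go d (ℕ.s≤s ℕ.z≤n) a≤a′

  part≤c : ∀ a → part la a ℕ.≤ c
  part≤c a = part-≤ k 1≤k c la a (Rows.narrow R)

  ∈D-room : ∀ y → y ∈D la → 1 ℕ.≤ proj₁ y × proj₁ y ℕ.+ c ℕ.≤ suc k
  ∈D-room (a , b) (1≤b , b≤) with go la a (ℕ.≤-trans 1≤b b≤)
    where
    go : ∀ la a → 1 ℕ.≤ part la a → 1 ℕ.≤ a × a ℕ.≤ length la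
    go (p ∷ ps) (suc zero) _ = ℕ.s≤s ℕ.z≤n , ℕ.s≤s ℕ.z≤n
    go (p ∷ ps) (suc (suc a)) h = ℕ.s≤s ℕ.z≤n , ℕ.s≤s (proj₂ (go ps (suc a) h))
  ... | 1≤a , a≤ = 1≤a , ℕ.≤-trans (ℕ.+-monoˡ-≤ c a≤) (ℕ.s≤s⁻¹ (Rows.room R))

  ∈D-≤c : ∀ y → y ∈D la → proj₂ y ℕ.≤ c
  ∈D-≤c (a , b) (_ , b≤) = ℕ.≤-trans b≤ (part≤c a)

  val-anti : ∀ {a a′} → 1 ℕ.≤ a → a ℕ.< a′ → val a′ ℤ.< val a
  val-anti 1≤a a<a′ = ℤ.+-mono-≤-< (ℤ.+≤+ (part-anti 1≤a (ℕ.<⇒≤ a<a′))) (1-a-anti k 1≤k c a<a′)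

  w-row : ∀ {a} → 1 ℕ.≤ a → a ℕ.+ c ℕ.≤ suc k → w (pos a) ≡ val a
  w-row {suc i} _ h = read-row k 1≤k c R i h

  w-col-< : ∀ a b → (a , b) ∈D la → w (+ b) ℤ.< val a
  w-col-< zero b (1≤b , b≤) = ⊥-elim (ℕ.<⇒≱ 1≤b b≤)
  w-col-< (suc i) b (1≤b , b≤) = ℤ.≤-<-trans
    (subst (λ z → w z ℤ.≤ + b - + suc i) (ℤ.+-identityʳ (+ b)) (read-col-< k 1≤k c R 1≤b i b≤))
    (ℤ.<-≤-trans (b-a<b+1-a k 1≤k c b (suc i)) (ℤ.+-monoˡ-≤ (pos (suc i)) (ℤ.+≤+ b≤)))

  w-col-> : ∀ {a b} → 1 ℕ.≤ a → b ℕ.≤ c → part la a ℕ.< b → val a ℤ.< w (+ b)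
  w-col-> {suc i} {b} _ b≤c p<b = ℤ.<-≤-trans (col-mono k 1≤k c (suc i) p<b)
    (subst (λ z → + b + pos (suc i) ℤ.≤ w z) (ℤ.+-identityʳ (+ b))
      (read-col-> k 1≤k c R (ℕ.≤-trans (ℕ.s≤s ℕ.z≤n) p<b) b≤c i p<b))

  -- A complete residue system modulo k + 1: the positions of the k + 1 - c rows of the box followed
  -- by those of its c columns.
  Window : ℤ → Set
  Window m = (+ c ℤ.< m + N) × m ℤ.≤ + c

  window-≡ : ∀ {m n} → Window m → Window n → _≋_ k m n → m ≡ n
  window-≡ (m> , m≤) (n> , n≤) e = ≋-near k e (ℤ.≤-<-trans m≤ n>) (ℤ.≤-<-trans n≤ m>)

  pos-≤0 : ∀ {a} → 1 ℕ.≤ a → pos a ℤ.≤ 0ℤ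
  pos-≤0 1≤a = ℤ.i≤j⇒i-j≤0 (ℤ.+≤+ 1≤a)

  window-pos : ∀ {a} → 1 ℕ.≤ a → a ℕ.+ c ℕ.≤ suc k → Window (pos a)
  window-pos {a} 1≤a h = 1-a-window k 1≤k c a h , ℤ.≤-trans (pos-≤0 1≤a) (ℤ.+≤+ ℕ.z≤n)

  window-col : ∀ {b} → b ℕ.≤ c → Window (+ b)
  window-col {b} b≤c = ℤ.+<+ (ℕ.<-≤-trans (ℕ.s≤s c≤k) (ℕ.m≤n+m (suc k) b)) , ℤ.+≤+ b≤c

  pos-injective : ∀ {a a′} → pos a ≡ pos a′ → a ≡ a′
  pos-injective {a} {a′} e = ℤ.+-injective (≡-by (sym e) (lem (+ a) (+ a′)))
    where
    lem : ∀ a a′ → 1ℤ - a - (1ℤ - a′) ≡ a′ - a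
    lem = solve-∀

  pos<col : ∀ {a b} → 1 ℕ.≤ a → 1 ℕ.≤ b → pos a ℤ.< + b
  pos<col = 1-a<b k 1≤k c

  pos≋̸col : ∀ y → y ∈D la → ¬ _≋_ k (pos (proj₁ y)) (+ proj₂ y)
  pos≋̸col y y∈ e = ℤ.<⇒≢ (pos<col (proj₁ (∈D-room y y∈)) (proj₁ y∈))
    (window-≡ (window-pos (proj₁ (∈D-room y y∈)) (proj₂ (∈D-room y y∈))) (window-col (∈D-≤c y y∈)) e)

  reflect-pos : ∀ a b {a′} → (a , b) ∈D la → 1 ℕ.≤ a′ → a′ ℕ.+ c ℕ.≤ suc k → a′ ≢ a →
                reflect (a , b) (pos a′) ≡ pos a′
  reflect-pos a b {a′} y∈ 1≤a′ h a′≢a = t-off k (pos a) (+ b) (pos a′)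
    (a′≢a ∘ pos-injective ∘ window-≡ win
      (window-pos (proj₁ (∈D-room (a , b) y∈)) (proj₂ (∈D-room (a , b) y∈))))
    (ℤ.<⇒≢ (pos<col 1≤a′ (proj₁ y∈)) ∘ window-≡ win (window-col (∈D-≤c (a , b) y∈)))
    where
    win = window-pos 1≤a′ h

  reflect-col : ∀ a b {b′} → (a , b) ∈D la → 1 ℕ.≤ b′ → b′ ℕ.≤ c → b′ ≢ b →
                reflect (a , b) (+ b′) ≡ + b′
  reflect-col a b {b′} y∈ 1≤b′ h b′≢b = t-off k (pos a) (+ b) (+ b′)
    (ℤ.<⇒≢ (pos<col (proj₁ (∈D-room (a , b) y∈)) 1≤b′) ∘ sym
      ∘ window-≡ (window-col h) (window-pos (proj₁ (∈D-room (a , b) y∈)) (proj₂ (∈D-room (a , b) y∈))))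
    (b′≢b ∘ ℤ.+-injective ∘ window-≡ (window-col h) (window-col (∈D-≤c (a , b) y∈)))

  -- `Y` holds the cells deleted so far, the latest first. The last three fields concern rows above
  -- all of `Y` only. A column that received the value of a lower row still satisfies them, since
  -- `val` decreases downwards.
  record State (x : Perm) (Y : List Cell) : Set where
    field
      sorted    : Sorted Y
      inside    : All (_∈D la) Y
      word      : prod k (wordMinus la Y) ≗ x
      untouched : ∀ {a} → 1 ℕ.≤ a → a ℕ.+ c ℕ.≤ suc k → a above Y → x (pos a) ≡ val a
      col-<     : ∀ a b → a above Y → (a , b) ∈D la → x (+ b) ℤ.< val a
      col->     : ∀ {a b} → 1 ℕ.≤ a → a above Y → b ℕ.≤ c → part la a ℕ.< b → val a ℤ.< x (+ b)

  initial : State w []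
  initial = record
    { sorted = []
    ; inside = []
    ; word = λ m → cong (λ X → prod k (wordOf X) m) (remove-nil k 1≤k c (readCells la))
    ; untouched = λ 1≤a h _ → w-row 1≤a h
    ; col-< = λ a b _ → w-col-< a b
    ; col-> = λ 1≤a _ → w-col-> 1≤a
    }

  module Step {x : Perm} {Y : List Cell} (S : State x Y) (a b : ℕ)
              (y∈ : (a , b) ∈D la) (a<Y : a above Y) where
    open State S

    1≤a : 1 ℕ.≤ a
    1≤a = proj₁ (∈D-room (a , b) y∈)

    a-room : a ℕ.+ c ℕ.≤ suc k
    a-room = proj₂ (∈D-room (a , b) y∈)

    x′ : Perm
    x′ = x ∘ reflect (a , b)

    x-pos : x (pos a) ≡ val a
    x-pos = untouched 1≤a a-room a<Y

    x′-col : x′ (+ b) ≡ val a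
    x′-col = trans (cong x (t-j k (pos a) (+ b) (pos≋̸col (a , b) y∈))) x-pos

    x′-pos : x′ (pos a) ≡ x (+ b)
    x′-pos = cong x (t-i k (pos a) (+ b))

    x′-col-other : ∀ {b′} → 1 ℕ.≤ b′ → b′ ℕ.≤ c → b′ ≢ b → x′ (+ b′) ≡ x (+ b′)
    x′-col-other 1≤b′ b′≤c b′≢b = cong x (reflect-col a b y∈ 1≤b′ b′≤c b′≢b)

    x′-pos-other : ∀ {a′} → 1 ℕ.≤ a′ → a′ ℕ.+ c ℕ.≤ suc k → a′ ≢ a → x′ (pos a′) ≡ x (pos a′)
    x′-pos-other 1≤a′ h a′≢a = cong x (reflect-pos a b y∈ 1≤a′ h a′≢a)

    del-word : ∀ m → prod k (wordMinus la Y) (reflect (a , b) m) ≡ prod k (wordMinus la ((a , b) ∷ Y)) m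
    del-word = proj₁ (deletion k 1≤k c {a , b} R y∈ a<Y)

    del-length : length (wordMinus la Y) ≡ suc (length (wordMinus la ((a , b) ∷ Y)))
    del-length = proj₂ (deletion k 1≤k c {a , b} R y∈ a<Y)

    next : State x′ ((a , b) ∷ Y)
    next = record
      { sorted = a<Y ∷ sorted
      ; inside = y∈ ∷ inside
      ; word = λ m → trans (sym (del-word m)) (word (reflect (a , b) m))
      ; untouched = λ { 1≤a′ h (a′<a ∷ a′<Y) →
          trans (x′-pos-other 1≤a′ h (ℕ.<⇒≢ a′<a)) (untouched 1≤a′ h a′<Y) }
      ; col-< = next-col-<
      ; col-> = next-col->
      }
      where
      next-col-< : ∀ a′ b′ → a′ above ((a , b) ∷ Y) → (a′ , b′) ∈D la → x′ (+ b′) ℤ.< val a′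
      next-col-< a′ b′ (a′<a ∷ a′<Y) y′∈ with b′ ℕ.≟ b
      ... | yes refl = subst (ℤ._< val a′) (sym x′-col) (val-anti (proj₁ (∈D-room (a′ , b′) y′∈)) a′<a)
      ... | no b′≢b = subst (ℤ._< val a′)
        (sym (x′-col-other (proj₁ y′∈) (∈D-≤c (a′ , b′) y′∈) b′≢b)) (col-< a′ b′ a′<Y y′∈)
      next-col-> : ∀ {a′ b′} → 1 ℕ.≤ a′ → a′ above ((a , b) ∷ Y) → b′ ℕ.≤ c →
                    part la a′ ℕ.< b′ → val a′ ℤ.< x′ (+ b′)
      -- b′ = b is impossible: row a reaches column b, and row a′ above it is at least as long.
      next-col-> {a′} {b′} 1≤a′ (a′<a ∷ a′<Y) b′≤c p<b′ = subst (val a′ ℤ.<_)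
        (sym (x′-col-other (ℕ.≤-trans (ℕ.s≤s ℕ.z≤n) p<b′) b′≤c λ { refl →
          ℕ.<⇒≱ p<b′ (ℕ.≤-trans (proj₂ y∈) (part-anti 1≤a′ (ℕ.<⇒≤ a′<a))) }))
        (col-> 1≤a′ a′<Y b′≤c p<b′)

  label : List Cell → Maybe ℤ
  label [] = nothing
  label ((a , _) ∷ _) = just (val a)

  Length-≗ : ∀ {x y m} → Length k x m → x ≗ y → Length k y m
  Length-≗ ((ws , l , e) , min) x≗y = (ws , l , λ m → trans (e m) (x≗y m))
    , λ vs f → min vs λ m → trans (f m) (sym (x≗y m))

  Length-unique : ∀ {x m n} → Length k x m → Length k x n → m ≡ n
  Length-unique ((ws , l , e) , min) ((vs , l′ , e′) , min′) = ℕ.≤-antisym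
    (ℕ.≤-trans (min vs e′) (ℕ.≤-reflexive l′)) (ℕ.≤-trans (min′ ws e) (ℕ.≤-reflexive l))

  -- Passes from the complete list of cells to those already deleted, which form its tail.
  ʳ++-suffix : ∀ {A : Set} (P : List A → Set) → (∀ {x xs} → P (x ∷ xs) → P xs) →
               ∀ xs {ys} → P (xs ʳ++ ys) → P ys
  ʳ++-suffix P tl [] p = p
  ʳ++-suffix P tl (x ∷ xs) p = tl (ʳ++-suffix P tl xs p)

  -- Undoing the last deletion lengthens x, because it moves the larger value
  -- back to the left; hence reducedness propagates from the end of the path.
  path-of-cells : ∀ {v} ps {x Y} → State x Y → Sorted (ps ʳ++ Y) → All (_∈D la) (ps ʳ++ Y) →
                  Reduced k (wordMinus la (ps ʳ++ Y)) → prod k (wordMinus la (ps ʳ++ Y)) ≗ v →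
                  IncPath k x (label Y) (map edge ps) v × Reduced k (wordMinus la Y)
  path-of-cells [] S _ _ red e = (λ m → trans (sym (State.word S m)) (e m)) , red
  path-of-cells {v} (y@(a , b) ∷ ps) {x} {Y} S so ins red e
    with ʳ++-suffix Sorted (λ { (_ ∷ h) → h }) ps {y ∷ Y} so
       | ʳ++-suffix (All (_∈D la)) (λ { (_ ∷ h) → h }) ps {y ∷ Y} ins
  ... | a<Y ∷ _ | y∈ ∷ _ =
      (edge-ok , increasing Y a<Y
        , subst (λ l → IncPath k x′ (just l) (map edge ps) v) (sym x′-col) (proj₁ rest))
    , red-Y
    where
    open Step S a b y∈ a<Y
    rest = path-of-cells ps next so ins red e
    red-Y : Reduced k (wordMinus la Y)
    red-Y = (wordMinus la Y , refl , λ _ → refl) , minimal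
      where
      minimal : ∀ ws → prod k ws ≗ prod k (wordMinus la Y) → length (wordMinus la Y) ℕ.≤ length ws
      minimal ws f with exchange-≗ k 1≤k {x} ws (λ m → trans (f m) (State.word S m))
                          (pos<col 1≤a (proj₁ y∈)) (subst (x (+ b) ℤ.<_) (sym x-pos) (State.col-< S a b a<Y y∈))
      ... | ws′ , l , f′ = subst₂ ℕ._≤_ (sym del-length) (sym l)
        (ℕ.s≤s (proj₂ (proj₂ rest) ws′ λ m → trans (f′ m) (sym (State.word next m))))
    edge-ok : EdgeCond k x (pos a) (+ b)
    edge-ok = pos-≤0 1≤a , ℤ.+<+ (proj₁ y∈) , pos≋̸col (a , b) y∈ ∘ res⇒≋ k {pos a} {+ b}
      , length (wordMinus la (y ∷ Y))
      , Length-≗ (subst (Length k _) del-length red-Y) (State.word S)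
      , Length-≗ (proj₂ rest) (State.word next)
    increasing : ∀ Y → a above Y → Above k (label Y) (x′ (+ b))
    increasing [] _ = tt
    increasing ((a′ , _) ∷ _) (a<a′ ∷ _) = subst (val a′ ℤ.<_) (sym x′-col) (val-anti 1≤a a<a′)

  -- right-< and at-≥ are (C2) read on values: for (a′ , b′) in Y, a next cell (a , b) with b′ < b
  -- and (a′ , b) in λ would leave x(b′) strictly between x(b) and x(1 − a).
  record PathState (x : Perm) (Y : List Cell) : Set where
    field
      state   : State x Y
      touched : ∀ {y Z} → Y ≡ y ∷ Z → ∀ {a} → 1 ℕ.≤ a → a ℕ.+ c ℕ.≤ suc k →
                proj₁ y ℕ.≤ a → x (pos a) ℤ.≤ val (proj₁ y)
      c2      : C2 la Y
      right-< : ∀ {y b} → y ∈ Y → proj₂ y ℕ.< b → b ℕ.≤ part la (proj₁ y) → x (+ b) ℤ.< val (proj₁ y)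
      at-≥    : ∀ {y} → y ∈ Y → val (proj₁ y) ℤ.≤ x (+ proj₂ y)

  initial-path : PathState w []
  initial-path = record
    { state = initial ; touched = λ () ; c2 = λ _ _ () ; right-< = λ () ; at-≥ = λ () }

  -- Every edge of a path deletes a cell

  perm-> : ∀ {X} {b m} → All (λ r → ¬ _≋_ k r b) (wordMinus la X) → ∀ {x} → prod k (wordMinus la X) ≗ x →
           b ℤ.< m → b ℤ.< x m
  perm-> {X} {b} {m} h e b<m = subst (b ℤ.<_) (e m) (prod-> k 1≤k (wordMinus la X) h b<m)

  perm-≤ : ∀ {X} {b m} → All (λ r → ¬ _≋_ k r b) (wordMinus la X) → ∀ {x} → prod k (wordMinus la X) ≗ x →
           m ℤ.≤ b → x m ℤ.≤ b
  perm-≤ {X} {b} {m} h e m≤b = subst (ℤ._≤ b) (e m) (prod-≤ k 1≤k (wordMinus la X) h m≤b)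

  -- No letter is congruent to c, so x preserves the cuts just above c and just above c - N. Outside
  -- the box one of these cuts would separate 1 - a from b and keep their images in increasing
  -- order.
  descent-window : ∀ {x Y a b} → prod k (wordMinus la Y) ≗ x → 1 ℕ.≤ a → 1 ℕ.≤ b →
                   x (+ b) ℤ.< x (pos a) → a ℕ.+ c ℕ.≤ suc k × b ℕ.≤ c
  descent-window {x} {Y} {a} {b} e 1≤a 1≤b x< = room , narrow
    where
    letters = wordMinus-≋̸ k 1≤k c R Y
    c-N : ℤ
    c-N = + c - N
    letters′ : All (λ r → ¬ _≋_ k r c-N) (wordMinus la Y)
    letters′ = All.map (λ r≋̸c r≋ → r≋̸c (≋-trans k r≋ ((- 1ℤ) by lem (+ c) N))) letters
      where
      lem : ∀ c n → c - n ≡ c + - 1ℤ * n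
      lem = solve-∀
    narrow : b ℕ.≤ c
    narrow with b ℕ.≤? c
    ... | yes b≤c = b≤c
    ... | no b≰c = ⊥-elim (ℤ.<⇒≱ x< (ℤ.≤-trans
      (perm-≤ {Y} letters e (ℤ.≤-trans (pos-≤0 1≤a) (ℤ.+≤+ ℕ.z≤n)))
      (ℤ.<⇒≤ (perm-> {Y} letters e (ℤ.+<+ (ℕ.≰⇒> b≰c))))))
    room : a ℕ.+ c ℕ.≤ suc k
    room with a ℕ.+ c ℕ.≤? suc k
    ... | yes h = h
    ... | no ¬h = ⊥-elim (ℤ.<⇒≱ x< (ℤ.≤-trans
      (perm-≤ {Y} letters′ e (≤-by (ℤ.+≤+ (ℕ.≰⇒> ¬h)) (lem (+ a) (+ c) N)))
      (ℤ.<⇒≤ (perm-> {Y} letters′ e (suc≤⇒<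
        (≤-by (ℤ.+-mono-≤ (ℤ.+≤+ c≤k) (ℤ.+≤+ (ℕ.z≤n {b}))) (lem₂ (+ b) (+ c) (+ k))))))))
      where
      lem : ∀ a c n → a + c - (1ℤ + n) ≡ c - n - (1ℤ - a)
      lem = solve-∀
      lem₂ : ∀ b c k → k + b - (c + 0ℤ) ≡ b - (1ℤ + (c - (1ℤ + k)))
      lem₂ = solve-∀

  above-head : ∀ {a Y} → Sorted Y → (∀ {y Z} → Y ≡ y ∷ Z → a ℕ.< proj₁ y) → a above Y
  above-head [] _ = []
  above-head (h ∷ _) f = f refl ∷ All.map (ℕ.<-trans (f refl)) h

  -- The edge is merely a cover with a larger label; the order of rows, membership in λ and (C2) are
  -- all read off from values of x.
  path-step : ∀ {x Y a b} → PathState x Y → EdgeCond k x (pos a) (+ b) →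
              Above k (label Y) (x (pos a)) →
              ((a , b) ∈D la) × (a above Y) × PathState (x ∘ reflect (a , b)) ((a , b) ∷ Y)
  path-step {x} {Y} {a} {b} PS (pos≤0 , 0<b , res≢ , m , len , len′) ab = y∈ , a<Y , new
    where
    open PathState PS
    open State state
    1≤b : 1 ℕ.≤ b
    1≤b = ℤ.drop‿+<+ 0<b
    1≤a′ : 1 ℕ.≤ a
    1≤a′ = ℤ.drop‿+≤+ (≤-by pos≤0 (lem (+ a)))
      where
      lem : ∀ a → 0ℤ - (1ℤ - a) ≡ a - 1ℤ
      lem = solve-∀
    ≋̸ : ¬ _≋_ k (pos a) (+ b)
    ≋̸ = res≢ ∘ ≋⇒res k
    x< : x (+ b) ℤ.< x (pos a)
    x< = edge-descent k 1≤k {x} (pos<col 1≤a′ 1≤b) ≋̸ len len′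
    window = descent-window {x} {Y} word 1≤a′ 1≤b x<
    -- By `touched`, a row at or below the last one holds at most the last label, whereas x(1 - a)
    -- is the new, larger one.
    head-below : ∀ {y Z} → Y ≡ y ∷ Z → a ℕ.< proj₁ y
    head-below {y} refl with a ℕ.<? proj₁ y
    ... | yes a<y = a<y
    ... | no a≮y = ⊥-elim (ℤ.<⇒≱ ab (touched refl 1≤a′ (proj₁ window) (ℕ.≮⇒≥ a≮y)))
    a<Y : a above Y
    a<Y = above-head sorted head-below
    x-a : x (pos a) ≡ val a
    x-a = untouched 1≤a′ (proj₁ window) a<Y
    -- If row a did not reach column b, `col->` would give x(b) > x(1 - a), contrary to the descent.
    y∈ : (a , b) ∈D la
    y∈ with b ℕ.≤? part la a
    ... | yes b≤ = 1≤b , b≤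
    ... | no b≰ = ⊥-elim (ℤ.<-asym x<
      (subst (ℤ._< x (+ b)) (sym x-a) (col-> 1≤a′ a<Y (proj₂ window) (ℕ.≰⇒> b≰))))
    open Step state a b y∈ a<Y
    -- Position b′ lies between 1 - a and b, and x(b) < `val a′` ≤ x(b′) < `val a` = x(1 - a), which
    -- a cover excludes.
    no-middle : ∀ {y} → y ∈ Y → proj₂ y ℕ.< b → ¬ b ℕ.≤ part la (proj₁ y)
    no-middle {a′ , b′} y′∈Y b′<b b≤ = cover-no-middle k 1≤k {x} (pos<col 1≤a (proj₁ y″∈)) (ℤ.+<+ b′<b)
      (pos≋̸col (a , b′) y″∈) (λ e → ℕ.<⇒≢ b′<b
        (ℤ.+-injective (window-≡ (window-col (∈D-≤c (a , b′) y″∈)) (window-col (∈D-≤c (a , b) y∈)) e)))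
      ≋̸ len len′ (ℤ.<-≤-trans (right-< y′∈Y b′<b b≤) (at-≥ y′∈Y))
      (subst (x (+ b′) ℤ.<_) (sym x-a) (col-< a b′ a<Y y″∈))
      where
      y′∈ : (a′ , b′) ∈D la
      y′∈ = All.lookup inside y′∈Y
      y″∈ : (a , b′) ∈D la
      y″∈ = proj₁ y′∈ , ℕ.≤-trans (proj₂ y′∈) (part-anti 1≤a (ℕ.<⇒≤ (All.lookup a<Y y′∈Y)))
    new-c2 : C2 la ((a , b) ∷ Y)
    new-c2 _ _ (here refl) (here refl) r< _ _ = ℕ.<-irrefl refl r<
    new-c2 _ _ (here refl) (there z∈) r< _ _ = ℕ.<-asym r< (All.lookup a<Y z∈)
    new-c2 _ _ (there z∈) (here refl) r< c< (_ , b≤) = no-middle z∈ c< b≤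
    new-c2 y z (there y∈Y) (there z∈Y) = c2 y z y∈Y z∈Y
    new-touched : ∀ {a′} → 1 ℕ.≤ a′ → a′ ℕ.+ c ℕ.≤ suc k → a ℕ.≤ a′ → x′ (pos a′) ℤ.≤ val a
    new-touched {a′} 1≤a″ h a≤a′ with ℕ.m≤n⇒m<n∨m≡n a≤a′
    ... | inj₂ refl = ℤ.<⇒≤ (subst₂ ℤ._<_ (sym x′-pos) x-pos x<)
    ... | inj₁ a<a′ = subst (ℤ._≤ val a) (sym (x′-pos-other 1≤a″ h (ℕ.<⇒≢ a<a′ ∘ sym))) (bound Y refl)
      where
      -- Rows strictly between a and the last row used are untouched; from the last row on, the old
      -- `touched` applies. Both bounds are below `val a`.
      bound : ∀ Y′ → Y ≡ Y′ → x (pos a′) ℤ.≤ val a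
      bound [] refl = ℤ.≤-trans (ℤ.≤-reflexive (untouched 1≤a″ h [])) (ℤ.<⇒≤ (val-anti 1≤a a<a′))
      bound (z ∷ Z) refl with proj₁ z ℕ.≤? a′
      ... | yes z≤ = ℤ.≤-trans (touched refl 1≤a″ h z≤) (ℤ.<⇒≤ (val-anti 1≤a (head-below refl)))
      ... | no z≰ = ℤ.≤-trans
        (ℤ.≤-reflexive (untouched 1≤a″ h (above-head sorted λ { refl → ℕ.≰⇒> z≰ })))
        (ℤ.<⇒≤ (val-anti 1≤a a<a′))
    new-right-< : ∀ {y b′} → y ∈ ((a , b) ∷ Y) → proj₂ y ℕ.< b′ → b′ ℕ.≤ part la (proj₁ y) →
                  x′ (+ b′) ℤ.< val (proj₁ y)
    new-right-< {y} {b′} y∈′ y<b′ b′≤ with b′ ℕ.≟ b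
    new-right-< (here refl) y<b′ b′≤ | yes refl = ⊥-elim (ℕ.<-irrefl refl y<b′)
    -- The column just changed cannot lie to the right of an older cell within the row of that cell.
    new-right-< (there z∈) y<b′ b′≤ | yes refl = ⊥-elim (no-middle z∈ y<b′ b′≤)
    new-right-< {y} {b′} y∈′ y<b′ b′≤ | no b′≢b = subst (ℤ._< val (proj₁ y))
      (sym (x′-col-other 1≤b′ (ℕ.≤-trans b′≤ (part≤c (proj₁ y))) b′≢b)) (old y∈′)
      where
      1≤b′ : 1 ℕ.≤ b′
      1≤b′ = ℕ.≤-trans (ℕ.s≤s ℕ.z≤n) y<b′
      old : y ∈ ((a , b) ∷ Y) → x (+ b′) ℤ.< val (proj₁ y)
      old (here refl) = col-< a b′ a<Y (1≤b′ , b′≤)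
      old (there z∈) = right-< z∈ y<b′ b′≤
    new-at-≥ : ∀ {y} → y ∈ ((a , b) ∷ Y) → val (proj₁ y) ℤ.≤ x′ (+ proj₂ y)
    new-at-≥ (here refl) = ℤ.≤-reflexive (sym x′-col)
    new-at-≥ {a′ , b′} (there z∈) with b′ ℕ.≟ b
    -- A column used again by a higher row receives a larger value than `val a′`.
    ... | yes refl = ℤ.≤-trans (ℤ.<⇒≤ (val-anti 1≤a (All.lookup a<Y z∈))) (ℤ.≤-reflexive (sym x′-col))
    ... | no b′≢b = subst (val a′ ℤ.≤_)
      (sym (x′-col-other (proj₁ (All.lookup inside z∈)) (∈D-≤c (a′ , b′) (All.lookup inside z∈)) b′≢b))
      (at-≥ z∈)
    new : PathState x′ ((a , b) ∷ Y)
    new = record { state = next ; touched = λ { refl → new-touched } ; c2 = new-c2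
                 ; right-< = new-right-< ; at-≥ = new-at-≥ }

  -- Each edge lowers the length by one and each deletion removes one letter, so the remaining word
  -- stays reduced along the path.
  cells-of-path : ∀ {v} ps {x Y} → PathState x Y → Reduced k (wordMinus la Y) →
                  IncPath k x (label Y) (map edge ps) v →
                  ValidX la (ps ʳ++ Y) × Reduced k (wordMinus la (ps ʳ++ Y))
                  × prod k (wordMinus la (ps ʳ++ Y)) ≗ v
  cells-of-path [] PS red e =
    (AllPairs⇒Linked sorted , inside , PathState.c2 PS) , red , λ m → trans (word m) (e m)
    where open State (PathState.state PS)
  cells-of-path {v} ((a , b) ∷ ps) {x} {Y} PS red (ec@(_ , _ , res≢ , m , len , len′) , ab , path)
    with path-step PS ec (subst (Above k (label Y)) (cong x (t-j k (pos a) (+ b) (res≢ ∘ ≋⇒res k))) ab)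
  ... | y∈ , a<Y , new = cells-of-path ps new red′
      (subst (λ l → IncPath k x′ (just l) (map edge ps) v) x′-col path)
    where
    open Step (PathState.state PS) a b y∈ a<Y
    m≡ : m ≡ length (wordMinus la ((a , b) ∷ Y))
    m≡ = ℕ.suc-injective (trans
      (Length-unique len (Length-≗ red (State.word (PathState.state PS)))) del-length)
    red′ : Reduced k (wordMinus la ((a , b) ∷ Y))
    red′ = Length-≗ (subst (Length k x′) m≡ len′) (sym ∘ State.word next)

  reduced-initial : Reduced k (wordMinus la [])
  reduced-initial = subst (λ X → Reduced k (wordOf X)) (sym (remove-nil k 1≤k c (readCells la)))
    (good-reduced k 1≤k c (good-readCells k 1≤k c R))

theorem4p18 : (k : ℕ) → 1 ≤ k → (c : ℕ) → c ≤ k → (n : ℕ) → 1 ≤ n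
    → (la : List ℕ) → IsPartition la → InBox k c la
    → (v : Perm) → D1Paths k n (wλ k la) v ↔ XSets k n la v
theorem4p18 k 1≤k c c≤k n _ la (linked , _) (short , narrow) v = mk↔ₛ′
  (λ (ps , [ p ]) → toCells ps , [ forward ps p ])
  (λ (X , [ q ]) → toEdges X , [ backward X q ])
  (λ (X , _) → Σ-≡ (toCells-toEdges X))
  -- The path p is available only irrelevantly, so the equality obtained from it is recomputed by
  -- deciding equality of vectors.
  (λ (ps , [ p ]) → Σ-≡ (recompute (Vec.≡-dec (≡-dec ℤ._≟_ ℤ._≟_) _ _) (toEdges-toCells k ps p)))
  where
  R : Rows k 1≤k c 1 la
  R = rows ℕ.≤-refl (ℕ.s≤s (ℕ.m≤o∸n⇒m+n≤o (length la) (ℕ.m≤n⇒m≤1+n c≤k) short)) narrow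
    (Linked⇒AllPairs (λ q≤p r≤q → ℕ.≤-trans r≤q q≤p) linked)

  Contributes : List Cell → Set
  Contributes X = ValidX la X × Reduced k (wordMinus la X) × prod k (wordMinus la X) ≗ v

  forward : (ps : Vec (ℤ × ℤ) n) → IncPath k (wλ k la) nothing (toList ps) v →
            Contributes (toList (toCells ps))
  forward ps p = subst Contributes (reverse-involutive (toList (toCells ps)))
    (cells-of-path k 1≤k c c≤k la R (reverse (toList (toCells ps))) (initial-path k 1≤k c c≤k la R)
      (reduced-initial k 1≤k c c≤k la R)
      (subst (λ es → IncPath k (wλ k la) nothing es v)
        (trans (cong toList (sym (toEdges-toCells k ps p))) (toList-toEdges (toCells ps))) p))

  backward : (X : Vec Cell n) → Contributes (toList X) →
             IncPath k (wλ k la) nothing (toList (toEdges X)) v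
  backward X q with subst Contributes (sym (reverse-involutive (toList X))) q
  ... | (linkedX , inside , _) , red , e =
    subst (λ es → IncPath k (wλ k la) nothing es v) (sym (toList-toEdges X))
      (proj₁ (path-of-cells k 1≤k c c≤k la R (reverse (toList X)) (initial k 1≤k c c≤k la R)
      (Linked⇒AllPairs ℕ.<-trans linkedX) inside red e))

  Σ-≡ : ∀ {A : Set} {B : A → Set} {x y : A} {p : Irrelevant (B x)} {q : Irrelevant (B y)} →
        x ≡ y → (x , p) ≡ (y , q)
  Σ-≡ refl = refl
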